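{- For every integer $k\geq 1$ there exists a constant $\epsilon_k>0$ such that for all integers $n\geq k+1$ we have $$r_{k+1,n}\geq \epsilon_k\, n^{k-2}.$$
   Context: For integers $1\leq m\leq n$, let $\Omega_{m,n}$ denote the set of all $m\times n$ real matrices all of whose entries are $\pm1$. For an $m\times n$ matrix $A$ with $m\leq n$, its permanent is $\mathrm{per}(A)=\sum_{\sigma}A_{1\sigma(1)}A_{2\sigma(2)}\cdots A_{m\sigma(m)}$, where the sum ranges over all injective functions $\sigma:\{1,\dots,m\}\to\{1,\dots,n\}$ (for $m=n$ this is the usual permanent). Let $r_{m,n}=|\{\mathrm{per}(A): A\in\Omega_{m,n}\}|$ be the number of distinct values of the permanent on $\Omega_{m,n}$. -}

module Defs where

open import Data.Nat using (ℕ; zero; suc)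
open import Data.Bool using (Bool; true; false; not; _∧_)
open import Data.Fin using (Fin; _≟_)
open import Data.List using (List; []; _∷_; map; concatMap; filterᵇ; allFin; length; deduplicate; foldr)
open import Data.Vec using (Vec; []; _∷_; lookup; toList)
open import Data.Integer as ℤ using (ℤ; +_; -[1+_])
open import Data.Bool.ListAction using (any)
open import Relation.Nullary.Decidable using (⌊_⌋)

data PM : Set where
  plus minus : PM

val : PM → ℤ
val plus  = + 1
val minus = -[1+ 0 ]

Mat : ℕ → ℕ → Set
Mat m n = Vec (Vec PM n) m

allVecsOf : {A : Set} → List A → (m : ℕ) → List (Vec A m)
allVecsOf xs zero    = [] ∷ []
allVecsOf xs (suc m) = concatMap (λ v → map (λ x → x ∷ v) xs) (allVecsOf xs m)

noDup : {n : ℕ} → List (Fin n) → Bool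
noDup []       = true
noDup (x ∷ xs) = not (any (λ y → ⌊ x ≟ y ⌋) xs) ∧ noDup xs

injections : (m n : ℕ) → List (Vec (Fin n) m)
injections m n = filterᵇ (λ σ → noDup (toList σ)) (allVecsOf (allFin n) m)

rowProd : {m n : ℕ} → Mat m n → Vec (Fin n) m → ℤ
rowProd []      []      = + 1
rowProd (r ∷ A) (j ∷ σ) = val (lookup r j) ℤ.* rowProd A σ

-- permanent of an m×n matrix (m ≤ n): sum over injective σ
per : {m n : ℕ} → Mat m n → ℤ
per {m} {n} A = foldr ℤ._+_ (+ 0) (map (rowProd A) (injections m n))

Ω : (m n : ℕ) → List (Mat m n)
Ω m n = allVecsOf (allVecsOf (plus ∷ minus ∷ []) n) m

r : ℕ → ℕ → ℕ
r m n = length (deduplicate ℤ._≟_ (map per (Ω m n)))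

{-# OPTIONS --safe #-}
-- The permanent of an m × n matrix is the coefficient of z₁⋯zₘ in the product of the column forms
-- 1 + Σᵢ aᵢⱼ zᵢ over ℤ[z₁,…,zₘ]/(z₁²,…,zₘ²), which is an m-fold iteration of dual numbers.  With m = k + 1,
-- write z for the first variable and x₁,…,xₖ for the others.  For t ≤ k there are 2ᵏ sign columns, running
-- over all sign patterns on x₁,…,xₖ, whose forms multiply to 1 + 2ᵏ t! z x₁⋯xₜ; negating their first
-- entries gives 1 - 2ᵏ t! z x₁⋯xₜ.  Take yₜ ≤ Y groups of the former kind and Y - yₜ of the latter for every t,
-- and N further columns of ones.  Since z² = 0, the permanent is C + Σₜ (2yₜ - Y) 2ᵏ t! N(N-1)⋯(N-k+t+1) with
-- C independent of y.  For N ≥ (Y + 1)k these weights drop by a factor of at least Y + 1 at each step, so the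
-- yₜ are the digits of a mixed radix expansion and all (Y + 1)ᵏ⁺¹ permanents differ.  As Y may be a fixed
-- fraction of n, this even bounds r from below by a constant multiple of nᵏ⁺¹.
module Submission where

open import Defs
open import Algebra.Bundles using (CommutativeRing; AbelianGroup)
open import Algebra.Construct.DirectProduct using (abelianGroup)
import Algebra.Solver.Ring.NaturalCoefficients.Default as SemiringSolver
open import Data.Bool using (Bool; true; false; not; _∧_; _∨_; if_then_else_)
open import Data.Bool.ListAction using (any; all)
open import Data.Bool.Properties using (∧-identityʳ; ∧-zeroʳ)
open import Data.Fin using (Fin; zero; suc; toℕ; _≟_; combine; funToFin; finToFun)
open import Data.Fin.Properties using (toℕ<n; toℕ-injective; injective⇒≤; funToFin-finToFin)
open import Data.Integer as ℤ using (ℤ; +_)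
import Data.Integer.Properties as ℤ
import Data.Integer.Tactic.RingSolver as ℤ-Solver
open import Data.List as List
  using (List; []; _∷_; map; concat; concatMap; filterᵇ; allFin; length; foldr; replicate; deduplicate; _++_)
open import Data.List.Membership.Propositional using (_∈_)
open import Data.List.Membership.Propositional.Properties using (∈-map⁺; ∈-concatMap⁺; ∈-deduplicate⁺)
open import Data.List.Properties using (length-++; length-map; length-replicate)
open import Data.List.Relation.Unary.Any as Any using (here; there)
open import Data.List.Relation.Unary.Any.Properties using (lookup-index)
open import Data.Nat as ℕ using (ℕ; zero; suc; z≤n; s≤s; _≤_; _<_; _∸_)
open import Data.Nat.Combinatorics.Base using (_P′_)
open import Data.Nat.DivMod using (_/_; _%_; m≡m%n+[m/n]*n; m%n<n; m/n*n≤m)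
import Data.Nat.Properties as ℕ
import Data.Nat.Tactic.RingSolver as ℕ-Solver
open import Data.Product using (Σ; _,_; _×_; proj₁; proj₂; ∃)
open import Data.Vec as Vec using (Vec; []; _∷_; head; tail; lookup; tabulate; toList)
open import Data.Vec.Properties using (lookup∘tabulate)
open import Data.Vec.Relation.Unary.All using (All; []; _∷_)
open import Function using (_∘_; const)
open import Level using (0ℓ)
open import Relation.Binary.PropositionalEquality as ≡ using (_≡_; module ≡-Reasoning)
open import Relation.Nullary using (yes; no; contradiction)
open import Relation.Nullary.Decidable using (⌊_⌋)

-- Dual numbers over a commutative ring.

-- The pair (a , b) stands for a + bε with ε² = 0. The result is again a commutative ring, so the
-- construction can be iterated, once for each row of a matrix.
Dual : CommutativeRing 0ℓ 0ℓ → CommutativeRing 0ℓ 0ℓ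
Dual R = record
  { _*_ = _⊗_
  ; 1#  = 1# , 0#
  ; isCommutativeRing = record
    { isRing = record
      { +-isAbelianGroup = AbelianGroup.isAbelianGroup (abelianGroup +-abelianGroup +-abelianGroup)
      ; *-cong = λ (p , p′) (q , q′) → *-cong p q , +-cong (*-cong p q′) (*-cong p′ q)
      ; *-assoc = λ _ _ _ → *-assoc _ _ _ , assoc₂ _ _ _ _ _ _
      ; *-identity = (λ _ → *-identityˡ _ , idˡ _ _) , (λ _ → *-identityʳ _ , idʳ _ _)
      ; distrib = (λ _ _ _ → distribˡ _ _ _ , dˡ _ _ _ _ _ _) , (λ _ _ _ → distribʳ _ _ _ , dʳ _ _ _ _ _ _)
      }
    ; *-comm = λ _ _ → *-comm _ _ , comm₂ _ _ _ _
    }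
  }
  where
  open CommutativeRing R
  open SemiringSolver commutativeSemiring using (solve; con; _:+_; _:*_; _:=_)
  _⊗_ : Carrier × Carrier → Carrier × Carrier → Carrier × Carrier
  (a , b) ⊗ (c , d) = a * c , a * d + b * c
  assoc₂ : ∀ a b c d e f → (a * c) * f + (a * d + b * c) * e ≈ a * (c * f + d * e) + b * (c * e)
  assoc₂ = solve 6 (λ a b c d e f → (a :* c) :* f :+ (a :* d :+ b :* c) :* e := a :* (c :* f :+ d :* e) :+ b :* (c :* e)) refl
  idˡ : ∀ a b → 1# * b + 0# * a ≈ b
  idˡ = solve 2 (λ a b → con 1 :* b :+ con 0 :* a := b) refl
  idʳ : ∀ a b → a * 0# + b * 1# ≈ b
  idʳ = solve 2 (λ a b → a :* con 0 :+ b :* con 1 := b) refl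
  dˡ : ∀ a b c d e f → a * (d + f) + b * (c + e) ≈ (a * d + b * c) + (a * f + b * e)
  dˡ = solve 6 (λ a b c d e f → a :* (d :+ f) :+ b :* (c :+ e) := (a :* d :+ b :* c) :+ (a :* f :+ b :* e)) refl
  dʳ : ∀ a b c d e f → (c + e) * b + (d + f) * a ≈ (c * b + d * a) + (e * b + f * a)
  dʳ = solve 6 (λ a b c d e f → (c :+ e) :* b :+ (d :+ f) :* a := (c :* b :+ d :* a) :+ (e :* b :+ f :* a)) refl
  comm₂ : ∀ a b c d → a * d + b * c ≈ c * b + d * a
  comm₂ = solve 4 (λ a b c d → a :* d :+ b :* c := c :* b :+ d :* a) refl

-- Sign columns and gadgets.

opp : PM → PM
opp plus  = minus
opp minus = plus

flipHead : ∀ {k} → Vec PM (suc k) → Vec PM (suc k)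
flipHead (ε ∷ c) = opp ε ∷ c

-- The sign of the distinguished variable z stays in front, so a new variable enters just behind it.
insert : ∀ {k} → PM → Vec PM (suc k) → Vec PM (suc (suc k))
insert a (ε ∷ c) = ε ∷ a ∷ c

-- The first entry belongs to the variable z.  It is the product of the signs of the first t variables (times
-- (-1)ᵗ, so that the weight below is positive) and does not depend on the signs of the remaining ones.
gadget : (t k : ℕ) → List (Vec PM (suc k))
gadget zero    zero    = (plus ∷ []) ∷ []
gadget (suc t) zero    = []
gadget zero    (suc k) = map (insert plus) (gadget 0 k) ++ map (insert minus) (gadget 0 k)
gadget (suc t) (suc k) = map (insert plus ∘ flipHead) (gadget t k) ++ map (insert minus) (gadget t k)

-- weight t k = 2ᵏ t! for t ≤ k.
weight : (t k : ℕ) → ℕ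
weight zero    zero    = 1
weight (suc t) zero    = 0
weight zero    (suc k) = 2 ℕ.* weight 0 k
weight (suc t) (suc k) = (2 ℕ.* suc t) ℕ.* weight t k

-- Products of linear forms in square-zero elements.

module Columns (R : CommutativeRing 0ℓ 0ℓ) where
  open CommutativeRing R hiding (zero)
  open import Algebra.Properties.CommutativeSemiring.Exp commutativeSemiring public
  open import Algebra.Properties.Semiring.Mult semiring public renaming (_×_ to _·_)
  open import Algebra.Properties.Ring (CommutativeRing.ring R) using (-‿distribˡ-*; -‿distribʳ-*; -‿involutive; -0#≈0#)
  open import Relation.Binary.Reasoning.Setoid setoid
  open SemiringSolver commutativeSemiring using (solve; con; _:+_; _:*_; _:=_)

  infixr 7 _∙_
  _∙_ : PM → Carrier → Carrier
  plus  ∙ x = x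
  minus ∙ x = - x

  opp-∙ : ∀ a x → opp a ∙ x ≈ a ∙ (- x)
  opp-∙ plus  x = refl
  opp-∙ minus x = sym (-‿involutive x)

  -- u + Σᵢ cᵢ xᵢ
  form : ∀ {k} → Carrier → Vec Carrier k → Vec PM k → Carrier
  form u []       []      = u
  form u (x ∷ xs) (a ∷ c) = form (u + a ∙ x) xs c

  form-cong : ∀ {k u v} (xs : Vec Carrier k) c → u ≈ v → form u xs c ≈ form v xs c
  form-cong []       []      p = p
  form-cong (x ∷ xs) (a ∷ c) p = form-cong xs c (+-congʳ p)

  prodOf : ∀ {A : Set} → (A → Carrier) → List A → Carrier
  prodOf f = foldr _*_ 1# ∘ map f

  prodOf-map : ∀ {A B : Set} {f : B → Carrier} {h : A → B} {g : A → Carrier} →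
               (∀ a → f (h a) ≈ g a) → ∀ l → prodOf f (map h l) ≈ prodOf g l
  prodOf-map p []      = refl
  prodOf-map p (a ∷ l) = *-cong (p a) (prodOf-map p l)

  prodOf-++ : ∀ {A : Set} (f : A → Carrier) l l′ → prodOf f (l ++ l′) ≈ prodOf f l * prodOf f l′
  prodOf-++ f []      l′ = sym (*-identityˡ _)
  prodOf-++ f (a ∷ l) l′ = trans (*-congˡ (prodOf-++ f l l′)) (sym (*-assoc _ _ _))

  -- A new variable only shifts the constant term. This is why `form` carries u as an accumulator
  -- and why the gadget identity can be proved by induction on the number of variables.
  form-insert : ∀ {k} u z x (xs : Vec Carrier k) a c →
                form u (z ∷ x ∷ xs) (insert a c) ≈ form (u + a ∙ x) (z ∷ xs) c
  form-insert u z x xs a (ε ∷ c) = form-cong xs c (swap u (ε ∙ z) (a ∙ x))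
    where
    swap : ∀ p q r → (p + q) + r ≈ (p + r) + q
    swap = solve 3 (λ p q r → (p :+ q) :+ r := (p :+ r) :+ q) refl

  form-flip : ∀ {k} u z (xs : Vec Carrier k) c → form u (z ∷ xs) (flipHead c) ≈ form u (- z ∷ xs) c
  form-flip u z xs (ε ∷ c) = form-cong xs c (+-congˡ (opp-∙ ε z))

  Square0 : Carrier → Set
  Square0 x = x * x ≈ 0#

  x*[-x] : ∀ {x} → Square0 x → x * - x ≈ 0#
  x*[-x] {x} p = trans (sym (-‿distribʳ-* x x)) (trans (-‿cong p) -0#≈0#)

  square0-neg : ∀ {x} → Square0 x → Square0 (- x)
  square0-neg {x} p = trans (sym (-‿distribˡ-* x (- x))) (trans (-‿cong (x*[-x] p)) -0#≈0#)

  ·-0 : ∀ n → n · 0# ≈ 0#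
  ·-0 zero    = refl
  ·-0 (suc n) = trans (+-identityˡ _) (·-0 n)

  ·-distrib-+ : ∀ n x y → n · x + n · y ≈ n · (x + y)
  ·-distrib-+ zero    x y = +-identityˡ 0#
  ·-distrib-+ (suc n) x y = trans (eq x (n · x) y (n · y)) (+-congˡ (·-distrib-+ n x y))
    where
    eq : ∀ a b c d → (a + b) + (c + d) ≈ (a + c) + (b + d)
    eq = solve 4 (λ a b c d → (a :+ b) :+ (c :+ d) := (a :+ c) :+ (b :+ d)) refl

  -- Since x² = 0, the binomial expansion stops after the linear term.
  binomial : ∀ u {x} → Square0 x → ∀ p → (u + x) ^ suc p ≈ u ^ suc p + suc p · (x * u ^ p)
  binomial u {x} sq zero = eq u x
    where
    eq : ∀ u x → (u + x) * 1# ≈ u * 1# + (x * 1# + 0#)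
    eq = solve 2 (λ u x → (u :+ x) :* con 1 := u :* con 1 :+ (x :* con 1 :+ con 0)) refl
  binomial u {x} sq (suc p) = begin
    (u + x) * (u + x) ^ suc p                              ≈⟨ *-congˡ (binomial u sq p) ⟩
    (u + x) * (u * w + suc p · (x * w))                    ≈⟨ expand u x w (suc p · (x * w)) ⟩
    u * (u * w) + (x * (u * w) + (u * suc p · (x * w) + x * suc p · (x * w)))
      ≈⟨ +-congˡ (+-congˡ (+-cong left right)) ⟩
    u * (u * w) + (x * (u * w) + (suc p · (x * (u * w)) + 0#)) ≈⟨ +-congˡ (+-congˡ (+-identityʳ _)) ⟩
    u * (u * w) + (x * (u * w) + suc p · (x * (u * w)))    ∎
    where
    w = u ^ p
    expand : ∀ u x w y → (u + x) * (u * w + y) ≈ u * (u * w) + (x * (u * w) + (u * y + x * y))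
    expand = solve 4 (λ u x w y → (u :+ x) :* (u :* w :+ y) := u :* (u :* w) :+ (x :* (u :* w) :+ (u :* y :+ x :* y))) refl
    comm₃ : ∀ u x w → u * (x * w) ≈ x * (u * w)
    comm₃ = solve 3 (λ u x w → u :* (x :* w) := x :* (u :* w)) refl
    left : u * suc p · (x * w) ≈ suc p · (x * (u * w))
    left = trans (×-comm-* (suc p) _ _) (×-congʳ (suc p) (comm₃ u x w))
    right : x * suc p · (x * w) ≈ 0#
    right = begin
      x * suc p · (x * w)   ≈⟨ ×-comm-* (suc p) _ _ ⟩
      suc p · (x * (x * w)) ≈⟨ ×-congʳ (suc p) (trans (sym (*-assoc _ _ _)) (trans (*-congʳ sq) (zeroˡ w))) ⟩
      suc p · 0#            ≈⟨ ·-0 (suc p) ⟩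
      0#                    ∎

  -- The expansions of both powers have the same constant term and opposite linear terms, so they
  -- differ by twice the linear term.
  difference : ∀ u {x} → Square0 x → ∀ p → (u + x) ^ suc p ≈ (u + - x) ^ suc p + (2 ℕ.* suc p) · (x * u ^ p)
  difference u {x} sq p = begin
    (u + x) ^ suc p                       ≈⟨ binomial u sq p ⟩
    U + D                                 ≈⟨ +-identityʳ _ ⟨
    U + D + 0#                            ≈⟨ +-congˡ D+D′≈0 ⟨
    U + D + (D + D′)                      ≈⟨ eq U D D′ ⟩
    (U + D′) + (D + (D + 0#))             ≈⟨ +-cong (sym (binomial u (square0-neg sq) p)) (×-assocˡ (x * u ^ p) 2 (suc p)) ⟩
    (u + - x) ^ suc p + (2 ℕ.* suc p) · (x * u ^ p) ∎
    where
    U = u ^ suc p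
    D = suc p · (x * u ^ p)
    D′ = suc p · (- x * u ^ p)
    D+D′≈0 : D + D′ ≈ 0#
    D+D′≈0 = begin
      D + D′                             ≈⟨ ·-distrib-+ (suc p) _ _ ⟩
      suc p · (x * u ^ p + - x * u ^ p)  ≈⟨ ×-congʳ (suc p) (distribʳ (u ^ p) x (- x)) ⟨
      suc p · ((x + - x) * u ^ p)        ≈⟨ ×-congʳ (suc p) (trans (*-congʳ (-‿inverseʳ x)) (zeroˡ _)) ⟩
      suc p · 0#                         ≈⟨ ·-0 (suc p) ⟩
      0#                                 ∎
    eq : ∀ a b c → (a + b) + (b + c) ≈ (a + c) + (b + (b + 0#))
    eq = solve 3 (λ a b c → (a :+ b) :+ (b :+ c) := (a :+ c) :+ (b :+ (b :+ con 0))) refl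

  monomial : ∀ {k} → ℕ → Vec Carrier k → Carrier
  monomial zero    xs       = 1#
  monomial (suc t) []       = 1#
  monomial (suc t) (x ∷ xs) = x * monomial t xs

  -- The left side is (u + w)² - x², and x² vanishes.
  conj-* : ∀ u {x} → Square0 x → ∀ w → (u + x + w) * (u + - x + w) ≈ (u + w) * (u + w)
  conj-* u {x} sq w = begin
    (u + x + w) * (u + - x + w)                              ≈⟨ eq u x (- x) w ⟩
    (u + w) * (u + w) + ((x + - x) * (u + w) + x * - x)      ≈⟨ +-congˡ (+-cong (trans (*-congʳ (-‿inverseʳ x)) (zeroˡ _)) (x*[-x] sq)) ⟩
    (u + w) * (u + w) + (0# + 0#)                            ≈⟨ eq′ ((u + w) * (u + w)) ⟩
    (u + w) * (u + w)                                        ∎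
    where
    eq : ∀ u x y w → ((u + x) + w) * ((u + y) + w) ≈ (u + w) * (u + w) + ((x + y) * (u + w) + x * y)
    eq = solve 4 (λ u x y w → ((u :+ x) :+ w) :* ((u :+ y) :+ w) := (u :+ w) :* (u :+ w) :+ ((x :+ y) :* (u :+ w) :+ x :* y)) refl
    eq′ : ∀ p → p + (0# + 0#) ≈ p
    eq′ = solve 1 (λ p → p :+ (con 0 :+ con 0) := p) refl

  conj-^ : ∀ u {x} → Square0 x → ∀ p → (u + x) ^ p * (u + - x) ^ p ≈ u ^ (p ℕ.+ p)
  conj-^ u {x} sq p = begin
    (u + x) ^ p * (u + - x) ^ p   ≈⟨ ^-distrib-* (u + x) (u + - x) p ⟨
    ((u + x) * (u + - x)) ^ p     ≈⟨ ^-congˡ p (*-cong (+-identityʳ _) (+-identityʳ _)) ⟨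
    ((u + x + 0#) * (u + - x + 0#)) ^ p ≈⟨ ^-congˡ p (conj-* u sq 0#) ⟩
    ((u + 0#) * (u + 0#)) ^ p     ≈⟨ ^-congˡ p (*-cong (+-identityʳ _) (+-identityʳ _)) ⟩
    (u * u) ^ p                   ≈⟨ ^-distrib-* u u p ⟩
    u ^ p * u ^ p                 ≈⟨ ^-homo-* u p p ⟨
    u ^ (p ℕ.+ p)                 ∎

  -- u is arbitrary because adding a variable x replaces u by u + x in one half of the columns and by u - x in
  -- the other; the two halves combine by (u + x)(u - x) = u² and (u + x)ˢ - (u - x)ˢ = 2 s x uˢ⁻¹.
  prodOf-gadget : ∀ {t k} → t ℕ.≤ k → ∃ λ e → ∀ (xs : Vec Carrier k) → All Square0 xs → ∀ z → Square0 z → ∀ u →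
                  prodOf (form u (z ∷ xs)) (gadget t k) ≈ u ^ e * (u ^ suc t + z * weight t k · monomial t xs)
  prodOf-gadget {zero} {zero} z≤n = 0 , λ { [] [] z _ u → eq u z }
    where
    eq : ∀ u z → (u + z) * 1# ≈ 1# * (u * 1# + z * (1# + 0#))
    eq = solve 2 (λ u z → (u :+ z) :* con 1 := con 1 :* (u :* con 1 :+ z :* (con 1 :+ con 0))) refl
  prodOf-gadget {zero} {suc k} z≤n = suc (e ℕ.+ e) , λ { (x ∷ xs) (sq ∷ sqs) z sz u → begin
      prodOf (form u (z ∷ x ∷ xs)) (gadget 0 (suc k))
        ≈⟨ prodOf-++ _ (map (insert plus) (gadget 0 k)) _ ⟩
      prodOf (form u (z ∷ x ∷ xs)) (map (insert plus) (gadget 0 k)) *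
        prodOf (form u (z ∷ x ∷ xs)) (map (insert minus) (gadget 0 k))
        ≈⟨ *-cong (trans (prodOf-map (form-insert u z x xs plus) (gadget 0 k)) (ih xs sqs z sz _))
                  (trans (prodOf-map (form-insert u z x xs minus) (gadget 0 k)) (ih xs sqs z sz _)) ⟩
      ((u + x) ^ e * ((u + x) * 1# + z * W)) * ((u + - x) ^ e * ((u + - x) * 1# + z * W))
        ≈⟨ shuffle ((u + x) ^ e) ((u + - x) ^ e) (u + x) (u + - x) (z * W) ⟩
      ((u + x) ^ e * (u + - x) ^ e) * ((u + x + z * W) * (u + - x + z * W))
        ≈⟨ *-cong (conj-^ u sq e) (conj-* u sq (z * W)) ⟩
      u ^ (e ℕ.+ e) * ((u + z * W) * (u + z * W))
        -- Squaring u + zW doubles the term linear in z, which accounts for the factor 2 in the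
        -- weight, and its quadratic term dies with z².
        ≈⟨ expand (u ^ (e ℕ.+ e)) u z W ⟩
      (u * u ^ (e ℕ.+ e)) * (u * 1# + z * (W + (W + 0#))) + u ^ (e ℕ.+ e) * ((z * z) * (W * W))
        ≈⟨ +-cong (*-congˡ (+-congˡ (*-congˡ (×-assocˡ 1# 2 (weight 0 k))))) (trans (*-congˡ (trans (*-congʳ sz) (zeroˡ _))) (zeroʳ _)) ⟩
      (u * u ^ (e ℕ.+ e)) * (u * 1# + z * (2 ℕ.* weight 0 k) · 1#) + 0#
        ≈⟨ +-identityʳ _ ⟩
      (u * u ^ (e ℕ.+ e)) * (u * 1# + z * (2 ℕ.* weight 0 k) · 1#) ∎ }
    where
    e  = proj₁ (prodOf-gadget {zero} {k} z≤n)
    ih = proj₂ (prodOf-gadget {zero} {k} z≤n)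
    W  = weight 0 k · 1#
    shuffle : ∀ A B p m y → (A * (p * 1# + y)) * (B * (m * 1# + y)) ≈ (A * B) * ((p + y) * (m + y))
    shuffle = solve 5 (λ A B p m y → (A :* (p :* con 1 :+ y)) :* (B :* (m :* con 1 :+ y)) := (A :* B) :* ((p :+ y) :* (m :+ y))) refl
    expand : ∀ A u z W → A * ((u + z * W) * (u + z * W)) ≈ (u * A) * (u * 1# + z * (W + (W + 0#))) + A * ((z * z) * (W * W))
    expand = solve 4 (λ A u z W → A :* ((u :+ z :* W) :* (u :+ z :* W)) := (u :* A) :* (u :* con 1 :+ z :* (W :+ (W :+ con 0))) :+ A :* ((z :* z) :* (W :* W))) refl
  -- The constant terms of the two halves multiply to u to the power 2(t + 1), and the linear term
  -- carries a factor uᵗ as well. Moving this uᵗ into the prefactor leaves the constant term at the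
  -- power t + 2 and adds t to the exponent e + e.
  prodOf-gadget {suc t} {suc k} (s≤s t≤k) = (e ℕ.+ e) ℕ.+ t , λ { (x ∷ xs) (sq ∷ sqs) z sz u →
    let W = weight t k · monomial t xs
        P = u + x
        M = u + - x
        n = 2 ℕ.* suc t
        D = n · (x * u ^ t)
    in begin
      prodOf (form u (z ∷ x ∷ xs)) (gadget (suc t) (suc k))
        ≈⟨ prodOf-++ _ (map (insert plus ∘ flipHead) (gadget t k)) _ ⟩
      prodOf (form u (z ∷ x ∷ xs)) (map (insert plus ∘ flipHead) (gadget t k)) *
        prodOf (form u (z ∷ x ∷ xs)) (map (insert minus) (gadget t k))
        ≈⟨ *-cong (trans (prodOf-map (λ c → trans (form-insert u z x xs plus (flipHead c)) (form-flip P z xs c)) (gadget t k))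
                         (ih xs sqs (- z) (square0-neg sz) P))
                  (trans (prodOf-map (form-insert u z x xs minus) (gadget t k)) (ih xs sqs z sz M)) ⟩
      (P ^ e * (P ^ suc t + - z * W)) * (M ^ e * (M ^ suc t + z * W))
        ≈⟨ expand (P ^ suc t) (M ^ suc t) z (- z) W (P ^ e) (M ^ e) ⟩
      (P ^ e * M ^ e) * (P ^ suc t * M ^ suc t + (W * (z * P ^ suc t + - z * M ^ suc t) + (z * - z) * (W * W)))
        ≈⟨ *-cong (conj-^ u sq e) (+-cong (conj-^ u sq (suc t)) (+-cong
             (*-congˡ (trans (+-congʳ (*-congˡ (difference u sq t))) (cancel z (- z) (M ^ suc t) D)))
             (trans (*-congʳ (x*[-x] sz)) (zeroˡ _)))) ⟩
      u ^ (e ℕ.+ e) * (u ^ (suc t ℕ.+ suc t) + (W * ((z + - z) * M ^ suc t + z * D) + 0#))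
        ≈⟨ *-congˡ (+-cong (trans (^-congʳ u (≡.cong suc (ℕ.+-suc t t))) (^-homo-* u (suc (suc t)) t))
             (+-congʳ (*-congˡ (+-congʳ (trans (*-congʳ (-‿inverseʳ z)) (zeroˡ _)))))) ⟩
      u ^ (e ℕ.+ e) * (u ^ suc (suc t) * u ^ t + (W * (0# + z * D) + 0#))
        ≈⟨ *-congˡ (+-congˡ (+-congʳ (*-congˡ (+-congˡ (*-congˡ (sym (×-assoc-* n x (u ^ t)))))))) ⟩
      u ^ (e ℕ.+ e) * (u ^ suc (suc t) * u ^ t + (W * (0# + z * ((n · x) * u ^ t)) + 0#))
        ≈⟨ regroup (u ^ (e ℕ.+ e)) (u ^ suc (suc t)) (u ^ t) z W (n · x) ⟩
      (u ^ (e ℕ.+ e) * u ^ t) * (u ^ suc (suc t) + z * ((n · x) * W))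
        ≈⟨ *-cong (sym (^-homo-* u (e ℕ.+ e) t)) (+-congˡ (*-congˡ (trans (×-assoc-* n x W)
             (trans (×-congʳ n (×-comm-* (weight t k) x (monomial t xs))) (×-assocˡ _ n (weight t k)))))) ⟩
      u ^ ((e ℕ.+ e) ℕ.+ t) * (u ^ suc (suc t) + z * (n ℕ.* weight t k) · (x * monomial t xs)) ∎ }
    where
    e  = proj₁ (prodOf-gadget t≤k)
    ih = proj₂ (prodOf-gadget t≤k)
    expand : ∀ p m z y W A B → (A * (p + y * W)) * (B * (m + z * W)) ≈ (A * B) * (p * m + (W * (z * p + y * m) + (z * y) * (W * W)))
    expand = solve 7 (λ p m z y W A B → (A :* (p :+ y :* W)) :* (B :* (m :+ z :* W)) := (A :* B) :* (p :* m :+ (W :* (z :* p :+ y :* m) :+ (z :* y) :* (W :* W)))) refl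
    cancel : ∀ z y m d → z * (m + d) + y * m ≈ (z + y) * m + z * d
    cancel = solve 4 (λ z y m d → z :* (m :+ d) :+ y :* m := (z :+ y) :* m :+ z :* d) refl
    regroup : ∀ A b v z W y → A * (b * v + (W * (0# + z * (y * v)) + 0#)) ≈ (A * v) * (b + z * (y * W))
    regroup = solve 6 (λ A b v z W y → A :* (b :* v :+ (W :* (con 0 :+ z :* (y :* v)) :+ con 0)) := (A :* v) :* (b :+ z :* (y :* W))) refl

-- Products over subsets of the columns and the Leibniz rule.

_without_ : ∀ {n} → (Fin n → Bool) → Fin n → Fin n → Bool
(S without j) i = S i ∧ not ⌊ j ≟ i ⌋

≟-suc : ∀ {n} (j i : Fin n) → ⌊ suc j ≟ suc i ⌋ ≡ ⌊ j ≟ i ⌋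
≟-suc j i with j ≟ i
... | yes _ = ≡.refl
... | no _ = ≡.refl

module Masked (R : CommutativeRing 0ℓ 0ℓ) where
  open CommutativeRing R hiding (zero)
  open import Algebra.Properties.Semiring.Sum semiring public
    using (sum; sum-cong-≋; *-distribˡ-sum)
  open import Algebra.Properties.Monoid.Sum *-monoid public
    renaming (sum to product; sum-cong-≋ to product-cong) using ()
  open import Relation.Binary.Reasoning.Setoid setoid

  -- Factors outside S become 1 instead of being removed, so the index type stays `Fin n` while
  -- columns are deleted.
  mask : ∀ {n} → (Fin n → Bool) → (Fin n → Carrier) → Fin n → Carrier
  mask S v j = if S j then v j else 1#

  mask-cong : ∀ {n} {S S′ : Fin n → Bool} (v : Fin n → Carrier) → (∀ j → S j ≡ S′ j) →
              product (mask S v) ≈ product (mask S′ v)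
  mask-cong v p = product-cong λ j → reflexive (≡.cong (λ b → if b then v j else 1#) (p j))

  -- The directional derivative along w of the product of the v j over S, as given by the Leibniz
  -- rule.
  derivative : ∀ {n} → (Fin n → Bool) → (v w : Fin n → Carrier) → Carrier
  derivative S v w = sum λ j → if S j then w j * product (mask (S without j) v) else 0#

  derivative-suc : ∀ {n} S (v w : Fin (suc n) → Carrier) →
                   derivative S v w ≈ (if S zero then w zero * product (mask (S ∘ suc) (v ∘ suc)) else 0#) +
                     mask S v zero * derivative (S ∘ suc) (v ∘ suc) (w ∘ suc)
  derivative-suc {n} S v w = +-cong (first (S zero)) (begin
    sum (λ j → if S (suc j) then w (suc j) * product (mask (S without suc j) v) else 0#)
      ≈⟨ sum-cong-≋ (λ j → later j (S (suc j))) ⟩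
    sum (λ j → mask S v zero * (if S (suc j) then w (suc j) * product (mask ((S ∘ suc) without j) (v ∘ suc)) else 0#))
      ≈⟨ *-distribˡ-sum {n} (mask S v zero) _ ⟨
    mask S v zero * derivative (S ∘ suc) (v ∘ suc) (w ∘ suc) ∎)
    where
    first : ∀ b → (if b then w zero * product (mask (S without zero) v) else 0#) ≈
                 (if b then w zero * product (mask (S ∘ suc) (v ∘ suc)) else 0#)
    first false = refl
    -- Deleting the index zero turns its own factor into 1 and does not change the mask on the
    -- others.
    first true  = *-congˡ (begin
      mask (S without zero) v zero * product (mask ((S without zero) ∘ suc) (v ∘ suc))
        ≈⟨ *-cong (reflexive (≡.cong (λ b → if b then v zero else 1#) (∧-zeroʳ (S zero))))
                  (mask-cong (v ∘ suc) (λ j → ∧-identityʳ (S (suc j)))) ⟩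
      1# * product (mask (S ∘ suc) (v ∘ suc)) ≈⟨ *-identityˡ _ ⟩
      product (mask (S ∘ suc) (v ∘ suc))      ∎)
    swap : ∀ a b c → a * (b * c) ≈ b * (a * c)
    swap a b c = trans (sym (*-assoc a b c)) (trans (*-congʳ (*-comm a b)) (*-assoc b a c))
    later : ∀ j b → (if b then w (suc j) * product (mask (S without suc j) v) else 0#) ≈
                   mask S v zero * (if b then w (suc j) * product (mask ((S ∘ suc) without j) (v ∘ suc)) else 0#)
    later j false = sym (zeroʳ _)
    later j true  = trans
      (*-congˡ (*-cong (reflexive (≡.cong (λ b → if b then v zero else 1#) (∧-identityʳ (S zero))))
                       (mask-cong (v ∘ suc) (λ i → ≡.cong (λ b → S (suc i) ∧ not b) (≟-suc j i)))))
      (swap _ _ _)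

  module D = CommutativeRing (Dual R)
  open import Algebra.Properties.Monoid.Sum D.*-monoid
    renaming (sum to productᴰ) using ()

  -- Multiplication of dual numbers is the product rule. Each term of the derivative deletes one
  -- column, exactly as the expansion of a permanent along a row does.
  product-mask-dual : ∀ {n} S (v w : Fin n → Carrier) →
    productᴰ (λ j → if S j then (v j , w j) else D.1#) D.≈ (product (mask S v) , derivative S v w)
  product-mask-dual {zero}  S v w = D.refl
  product-mask-dual {suc n} S v w = D.trans
    (D.*-congˡ {x = if S zero then (v zero , w zero) else D.1#} (product-mask-dual (S ∘ suc) (v ∘ suc) (w ∘ suc)))
    (D.trans (step (S zero)) (refl , sym (derivative-suc S v w)))
    where
    P = product (mask (S ∘ suc) (v ∘ suc))
    Δ = derivative (S ∘ suc) (v ∘ suc) (w ∘ suc)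
    step : ∀ b → (if b then (v zero , w zero) else D.1#) D.* (P , Δ) D.≈
                 ((if b then v zero else 1#) * P , (if b then w zero * P else 0#) + (if b then v zero else 1#) * Δ)
    step true  = refl , +-comm _ _
    step false = refl , trans (+-congˡ (zeroˡ P)) (+-comm _ _)

-- The iterated dual numbers and their top coefficient.

-- Tower m = ℤ[z₁,…,zₘ]/(z₁²,…,zₘ²); the outermost dual variable belongs to the first row of a matrix.
Tower : ℕ → CommutativeRing 0ℓ 0ℓ
Tower zero    = ℤ.+-*-commutativeRing
Tower (suc m) = Dual (Tower m)

module T (m : ℕ) where
  open CommutativeRing (Tower m) public
  open Columns (Tower m) public
  open Masked (Tower m) public

-- The coefficient of z₁⋯zₘ, found by taking the ε-part at every level.
top : ∀ m → T.Carrier m → ℤ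
top zero    a       = a
top (suc m) (a , b) = top m b

top-cong : ∀ m {x y} → T._≈_ m x y → top m x ≡ top m y
top-cong zero    p       = p
top-cong (suc m) (_ , q) = top-cong m q

top-+ : ∀ m x y → top m (T._+_ m x y) ≡ top m x ℤ.+ top m y
top-+ zero    x y = ≡.refl
top-+ (suc m) _ _ = top-+ m _ _

top-neg : ∀ m x → top m (T.-_ m x) ≡ ℤ.- top m x
top-neg zero    x = ≡.refl
top-neg (suc m) _ = top-neg m _

top-0 : ∀ m → top m (T.0# m) ≡ + 0
top-0 zero    = ≡.refl
top-0 (suc m) = top-0 m

open import Algebra.Properties.CommutativeMonoid.Sum ℤ.+-0-commutativeMonoid
  using (sum; sum-cong-≗; ∑-distrib-+; sum-replicate-zero)

top-sum : ∀ m {n} (f : Fin n → T.Carrier m) → top m (T.sum m f) ≡ sum (top m ∘ f)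
top-sum m {zero}  f = top-0 m
top-sum m {suc n} f = ≡.trans (top-+ m _ _) (≡.cong (ℤ._+_ (top m (f zero))) (top-sum m (f ∘ suc)))

top-sign : ∀ m a x → top m (T._*_ m (T._∙_ m a (T.1# m)) x) ≡ val a ℤ.* top m x
top-sign m plus  x = ≡.trans (top-cong m (T.*-identityˡ m x)) (≡.sym (ℤ.*-identityˡ (top m x)))
top-sign m minus x = ≡.trans (top-cong m (T.trans m (T.sym m (-‿distribˡ-* _ _)) (T.-‿cong m (T.*-identityˡ m x))))
  (≡.trans (top-neg m x) (≡.sym (ℤ.-1*i≡-i (top m x))))
  where open import Algebra.Properties.Ring (CommutativeRing.ring (Tower m)) using (-‿distribˡ-*)

-- Finite sums over lists.

∑ : {A : Set} → List A → (A → ℤ) → ℤ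
∑ l f = foldr ℤ._+_ (+ 0) (map f l)

∑-cong : ∀ {A : Set} {f g : A → ℤ} → (∀ a → f a ≡ g a) → ∀ l → ∑ l f ≡ ∑ l g
∑-cong p []      = ≡.refl
∑-cong p (a ∷ l) = ≡.cong₂ ℤ._+_ (p a) (∑-cong p l)

∑-zero : ∀ {A : Set} (l : List A) → ∑ l (const (+ 0)) ≡ + 0
∑-zero []      = ≡.refl
∑-zero (a ∷ l) = ≡.trans (ℤ.+-identityˡ _) (∑-zero l)

∑-*ˡ : ∀ {A : Set} c (l : List A) f → ∑ l (λ a → c ℤ.* f a) ≡ c ℤ.* ∑ l f
∑-*ˡ c []      f = ≡.sym (ℤ.*-zeroʳ c)
∑-*ˡ c (a ∷ l) f = ≡.trans (≡.cong (ℤ._+_ (c ℤ.* f a)) (∑-*ˡ c l f)) (≡.sym (ℤ.*-distribˡ-+ c (f a) _))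

∑-++ : ∀ {A : Set} (l l′ : List A) f → ∑ (l ++ l′) f ≡ ∑ l f ℤ.+ ∑ l′ f
∑-++ []      l′ f = ≡.sym (ℤ.+-identityˡ _)
∑-++ (a ∷ l) l′ f = ≡.trans (≡.cong (ℤ._+_ (f a)) (∑-++ l l′ f)) (≡.sym (ℤ.+-assoc (f a) _ _))

∑-map : ∀ {A B : Set} (h : A → B) l f → ∑ (map h l) f ≡ ∑ l (f ∘ h)
∑-map h []      f = ≡.refl
∑-map h (a ∷ l) f = ≡.cong (ℤ._+_ (f (h a))) (∑-map h l f)

∑-concatMap : ∀ {A B : Set} (h : A → List B) l f → ∑ (concatMap h l) f ≡ ∑ l (λ a → ∑ (h a) f)
∑-concatMap h []      f = ≡.refl
∑-concatMap h (a ∷ l) f = ≡.trans (∑-++ (h a) _ f) (≡.cong (ℤ._+_ (∑ (h a) f)) (∑-concatMap h l f))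

∑-tabulate : ∀ {n} {A : Set} (g : Fin n → A) f → ∑ (List.tabulate g) f ≡ sum (f ∘ g)
∑-tabulate {zero}  g f = ≡.refl
∑-tabulate {suc n} g f = ≡.cong (ℤ._+_ (f (g zero))) (∑-tabulate (g ∘ suc) f)

∑-sum-swap : ∀ {A : Set} {n} (l : List A) (f : A → Fin n → ℤ) →
             ∑ l (λ a → sum (f a)) ≡ sum (λ x → ∑ l (λ a → f a x))
∑-sum-swap {n = n} [] f = ≡.sym (sum-replicate-zero n)
∑-sum-swap (a ∷ l) f = ≡.trans (≡.cong (ℤ._+_ (sum (f a))) (∑-sum-swap l f)) (≡.sym (∑-distrib-+ (f a) _))

-- Expansion of the permanent along the first row.

-- Restricting to the columns in S lets the expansion along the first row be iterated.
perOn : ∀ {m n} → (Fin n → Bool) → Mat m n → ℤ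
perOn {m} {n} S A = ∑ (allVecsOf (allFin n) m)
  λ σ → if noDup (toList σ) ∧ all S (toList σ) then rowProd A σ else + 0

all-without : ∀ {n} (S : Fin n → Bool) x l → all (S without x) l ≡ all S l ∧ not (any (λ y → ⌊ x ≟ y ⌋) l)
all-without S x []      = ≡.refl
all-without S x (y ∷ l) = ≡.trans (≡.cong (((S without x) y) ∧_) (all-without S x l)) (lemma (S y) ⌊ x ≟ y ⌋ _ _)
  where
  lemma : ∀ a b c d → (a ∧ not b) ∧ (c ∧ not d) ≡ (a ∧ c) ∧ not (b ∨ d)
  lemma false b     c     d = ≡.refl
  lemma true  true  false d = ≡.refl
  lemma true  true  true  d = ≡.refl
  lemma true  false c     d = ≡.refl

-- A sequence starting with x is injective with values in S exactly if x lies in S and the rest is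
-- injective with values in S without x. The two sums are exchanged because `allVecsOf` runs through
-- the tails in its outer loop.
perOn-∷ : ∀ {m n} S (r : Vec PM n) (A : Mat m n) →
          perOn S (r ∷ A) ≡ sum (λ x → if S x then val (lookup r x) ℤ.* perOn (S without x) A else + 0)
perOn-∷ {m} {n} S r A = begin
  perOn S (r ∷ A)
    ≡⟨ ∑-concatMap (λ σ → map (_∷ σ) (allFin n)) σs term ⟩
  ∑ σs (λ σ → ∑ (map (_∷ σ) (allFin n)) term)
    ≡⟨ ∑-cong (λ σ → ≡.trans (∑-map (_∷ σ) (allFin n) term) (∑-tabulate (λ x → x) (λ x → term (x ∷ σ)))) σs ⟩
  ∑ σs (λ σ → sum (λ x → term (x ∷ σ)))
    ≡⟨ ∑-sum-swap σs (λ σ x → term (x ∷ σ)) ⟩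
  sum (λ x → ∑ σs (λ σ → term (x ∷ σ)))
    ≡⟨ sum-cong-≗ (λ x → ≡.trans (∑-cong (split x) σs) (collect x (S x))) ⟩
  sum (λ x → if S x then val (lookup r x) ℤ.* perOn (S without x) A else + 0) ∎
  where
  open ≡-Reasoning
  σs = allVecsOf (allFin n) m
  term : Vec (Fin n) (suc m) → ℤ
  term σ = if noDup (toList σ) ∧ all S (toList σ) then rowProd (r ∷ A) σ else + 0
  term′ : Fin n → Vec (Fin n) m → ℤ
  term′ x σ = if noDup (toList σ) ∧ all (S without x) (toList σ) then rowProd A σ else + 0
  -- Here a says that x occurs in σ, b that σ has no repetition, c that x lies in S, and d that σ
  -- stays in S.
  cases : ∀ a b c d (v p : ℤ) → (if (not a ∧ b) ∧ (c ∧ d) then v ℤ.* p else + 0) ≡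
          (if c then v ℤ.* (if b ∧ (d ∧ not a) then p else + 0) else + 0)
  cases a     b     false d     v p rewrite ∧-zeroʳ (not a ∧ b) = ≡.refl
  cases true  false true  d     v p = ≡.sym (ℤ.*-zeroʳ v)
  cases true  true  true  d     v p rewrite ∧-zeroʳ d = ≡.sym (ℤ.*-zeroʳ v)
  cases false false true  d     v p = ≡.sym (ℤ.*-zeroʳ v)
  cases false true  true  false v p = ≡.sym (ℤ.*-zeroʳ v)
  cases false true  true  true  v p = ≡.refl
  split : ∀ x σ → term (x ∷ σ) ≡ (if S x then val (lookup r x) ℤ.* term′ x σ else + 0)
  split x σ rewrite all-without S x (toList σ) =
    cases (any (λ y → ⌊ x ≟ y ⌋) (toList σ)) (noDup (toList σ)) (S x) (all S (toList σ)) (val (lookup r x)) (rowProd A σ)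
  collect : ∀ x b → ∑ σs (λ σ → if b then val (lookup r x) ℤ.* term′ x σ else + 0) ≡
            (if b then val (lookup r x) ℤ.* ∑ σs (term′ x) else + 0)
  collect x true  = ∑-*ˡ (val (lookup r x)) σs (term′ x)
  collect x false = ∑-zero σs

perOn-full : ∀ {m n} (A : Mat m n) → per A ≡ perOn (const true) A
perOn-full {m} {n} A = filter-sum (allVecsOf (allFin n) m)
  where
  all-true : (l : List (Fin n)) → all (const true) l ≡ true
  all-true []      = ≡.refl
  all-true (_ ∷ l) = all-true l
  filter-sum : ∀ l → ∑ (filterᵇ (λ σ → noDup (toList σ)) l) (rowProd A) ≡
               ∑ l (λ σ → if noDup (toList σ) ∧ all (const true) (toList σ) then rowProd A σ else + 0)
  filter-sum []      = ≡.refl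
  filter-sum (σ ∷ l) rewrite all-true (toList σ) with noDup (toList σ)
  ... | true  = ≡.cong (ℤ._+_ (rowProd A σ)) (filter-sum l)
  ... | false = ≡.trans (filter-sum l) (≡.sym (ℤ.+-identityˡ _))

-- The permanent as a top coefficient.

-- The column form 1 + Σᵢ aᵢⱼ zᵢ in coordinates: every row contributes its sign as the coefficient
-- of the outermost variable.
column : ∀ {m n} → Mat m n → Fin n → T.Carrier m
column         []      j = + 1
column {suc m} (r ∷ A) j = column A j , T._∙_ m (lookup r j) (T.1# m)

-- Induction on the rows: the ε-part of the product is its derivative, and this matches the
-- expansion along the first row term by term.
top-column : ∀ {m n} S (A : Mat m n) → top m (T.product m (T.mask m S (column A))) ≡ perOn S A
top-column S [] = ones S
  where
  ones : ∀ {n} (S : Fin n → Bool) → T.product 0 (T.mask 0 S (const (+ 1))) ≡ + 1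
  ones {zero}  S = ≡.refl
  ones {suc n} S with S zero
  ... | true  = ≡.trans (ℤ.*-identityˡ _) (ones (S ∘ suc))
  ... | false = ≡.trans (ℤ.*-identityˡ _) (ones (S ∘ suc))
top-column {suc m} {n} S (r ∷ A) = begin
  top (suc m) (T.product (suc m) (T.mask (suc m) S (column (r ∷ A))))
    ≡⟨ top-cong (suc m) (T.product-mask-dual m S (column A) (λ j → T._∙_ m (lookup r j) (T.1# m))) ⟩
  top m (T.derivative m S (column A) (λ j → T._∙_ m (lookup r j) (T.1# m)))
    ≡⟨ top-sum m {n} _ ⟩
  sum (λ j → top m (if S j then T._*_ m (T._∙_ m (lookup r j) (T.1# m)) (minor j) else T.0# m))
    ≡⟨ sum-cong-≗ (λ j → term j (S j)) ⟩
  sum (λ j → if S j then val (lookup r j) ℤ.* perOn (S without j) A else + 0)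
    ≡⟨ perOn-∷ S r A ⟨
  perOn S (r ∷ A) ∎
  where
  open ≡-Reasoning
  minor = λ j → T.product m (T.mask m (S without j) (column A))
  term : ∀ j b → top m (if b then T._*_ m (T._∙_ m (lookup r j) (T.1# m)) (minor j) else T.0# m) ≡
         (if b then val (lookup r j) ℤ.* perOn (S without j) A else + 0)
  term j false = top-0 m
  term j true  = ≡.trans (top-sign m (lookup r j) (minor j)) (≡.cong (ℤ._*_ (val (lookup r j))) (top-column (S without j) A))

matrix : ∀ {m n} → (Fin n → Vec PM m) → Mat m n
matrix {zero}  cs = []
matrix {suc m} cs = tabulate (head ∘ cs) ∷ matrix (tail ∘ cs)

-- The variables z₁,...,zₘ. The first is the ε of the outermost level, and the others are embedded
-- as constants from the level below.
generators : ∀ m → Vec (T.Carrier m) m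
generators zero    = []
generators (suc m) = (T.0# m , T.1# m) ∷ Vec.map (_, T.0# m) (generators m)

-- The same ring element as `column`, up to the equality proved in `column-matrix`, but written as a
-- `form` so that the identities for products of forms apply.
columnForm : ∀ m → Vec PM m → T.Carrier m
columnForm m = T.form m (T.1# m) (generators m)

-- Calculation with coordinates of dual numbers.

module DualLemmas (R : CommutativeRing 0ℓ 0ℓ) where
  open CommutativeRing R hiding (zero)
  open import Algebra.Properties.Ring (CommutativeRing.ring R) using (-0#≈0#)
  private
    module D = CommutativeRing (Dual R)
    module C = Columns R
    module CD = Columns (Dual R)
  open C using (_∙_; _·_; _^_)

  ∙-0 : ∀ a → a ∙ 0# ≈ 0#
  ∙-0 plus  = refl
  ∙-0 minus = -0#≈0#

  ∙-dual : ∀ a x y → (a CD.∙ (x , y)) D.≈ (a ∙ x , a ∙ y)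
  ∙-dual plus  x y = D.refl
  ∙-dual minus x y = D.refl

  form-dual : ∀ {k} u w (xs : Vec Carrier k) c →
              CD.form (u , w) (Vec.map (_, 0#) xs) c D.≈ (C.form u xs c , w)
  form-dual u w []       []      = D.refl
  form-dual u w (x ∷ xs) (a ∷ c) = D.trans
    (CD.form-cong (Vec.map (_, 0#) xs) c
      (D.trans (D.+-congˡ {x = u , w} (∙-dual a x 0#)) (refl , trans (+-congˡ (∙-0 a)) (+-identityʳ w))))
    (form-dual (u + a ∙ x) w xs c)

  monomial-dual : ∀ {k} t (xs : Vec Carrier k) →
                  CD.monomial t (Vec.map (_, 0#) xs) D.≈ (C.monomial t xs , 0#)
  monomial-dual zero    xs       = D.refl
  monomial-dual (suc t) []       = D.refl
  monomial-dual (suc t) (x ∷ xs) = D.trans (D.*-congˡ {x = x , 0#} (monomial-dual t xs))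
    (refl , trans (+-cong (zeroʳ x) (zeroˡ _)) (+-identityˡ 0#))

  ·-dual : ∀ n x y → (n CD.· (x , y)) D.≈ (n · x , n · y)
  ·-dual zero    x y = D.refl
  ·-dual (suc n) x y = D.+-congˡ {x = x , y} (·-dual n x y)

  square0-dual : ∀ {k} {xs : Vec Carrier k} → All C.Square0 xs → All CD.Square0 (Vec.map (_, 0#) xs)
  square0-dual []         = []
  square0-dual (sq ∷ sqs) = (sq , trans (+-cong (zeroʳ _) (zeroˡ _)) (+-identityˡ 0#)) ∷ square0-dual sqs

  infinitesimal-* : ∀ w x y → (0# , w) D.* (x , y) D.≈ (0# , w * x)
  infinitesimal-* w x y = zeroˡ x , trans (+-congʳ (zeroˡ y)) (+-identityˡ _)

  -- Elements with constant part 1 multiply by adding their ε-parts, which turns the product of all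
  -- gadget groups into a sum.
  unipotent-* : ∀ β γ → (1# , β) D.* (1# , γ) D.≈ (1# , β + γ)
  unipotent-* β γ = *-identityˡ 1# , trans (+-cong (*-identityˡ γ) (*-identityʳ β)) (+-comm γ β)

  proj₁-^ : ∀ x n → proj₁ (x CD.^ n) ≈ proj₁ x ^ n
  proj₁-^ x zero    = refl
  proj₁-^ x (suc n) = *-congˡ (proj₁-^ x n)

  -- The power rule: the ε-part of a power of σ + ε is the derivative of that power at σ.
  proj₂-^ : ∀ σ n → proj₂ ((σ , 1#) CD.^ suc n) ≈ suc n · (σ ^ n)
  proj₂-^ σ zero    = trans (+-cong (zeroʳ σ) (*-identityˡ 1#)) (+-comm 0# 1#)
  proj₂-^ σ (suc n) = begin
    σ * proj₂ ((σ , 1#) CD.^ suc n) + 1# * proj₁ ((σ , 1#) CD.^ suc n)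
      ≈⟨ +-cong (*-congˡ (proj₂-^ σ n)) (trans (*-identityˡ _) (proj₁-^ (σ , 1#) (suc n))) ⟩
    σ * (suc n · (σ ^ n)) + σ ^ suc n  ≈⟨ +-congʳ (C.×-comm-* (suc n) σ (σ ^ n)) ⟩
    suc n · (σ ^ suc n) + σ ^ suc n    ≈⟨ +-comm _ _ ⟩
    suc (suc n) · (σ ^ suc n)          ∎
    where open import Relation.Binary.Reasoning.Setoid setoid

module DL (m : ℕ) = DualLemmas (Tower m)

-- Among the generators only the first has an ε-part, so the first sign becomes the ε-part and the
-- other signs give a form one level down.
columnForm-∷ : ∀ m a c → T._≈_ (suc m) (columnForm (suc m) (a ∷ c)) (columnForm m c , T._∙_ m a (T.1# m))
columnForm-∷ m a c = T.trans (suc m)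
  (T.form-cong (suc m) (Vec.map (_, T.0# m) (generators m)) c
    (T.trans (suc m) (T.+-congˡ (suc m) {x = T.1# (suc m)} (DL.∙-dual m a _ _))
      (T.trans m (T.+-congˡ m (DL.∙-0 m a)) (T.+-identityʳ m _) , T.+-identityˡ m _)))
  (DL.form-dual m _ _ (generators m) c)

column-matrix : ∀ {m n} (cs : Fin n → Vec PM m) j → T._≈_ m (column (matrix cs) j) (columnForm m (cs j))
column-matrix {zero}  cs j with cs j
... | [] = ≡.refl
column-matrix {suc m} cs j = T.trans (suc m)
  (column-matrix (tail ∘ cs) j , T.reflexive m (≡.cong (λ a → T._∙_ m a (T.1# m)) (lookup∘tabulate (head ∘ cs) j)))
  (T.trans (suc m) (T.sym (suc m) (columnForm-∷ m (head (cs j)) (tail (cs j))))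
    (T.reflexive (suc m) (≡.cong (columnForm (suc m)) (η (cs j)))))
  where
  η : ∀ {m} (c : Vec PM (suc m)) → head c ∷ tail c ≡ c
  η (a ∷ c) = ≡.refl

product-lookup : ∀ m {A : Set} (f : A → T.Carrier m) l → T._≈_ m (T.product m (f ∘ List.lookup l)) (T.prodOf m f l)
product-lookup m f []      = T.refl m
product-lookup m f (a ∷ l) = T.*-congˡ m (product-lookup m f l)

-- From here on permanents are computed by multiplying column forms, which may be grouped at will.
per-matrix : ∀ {m} (l : List (Vec PM m)) → per (matrix (List.lookup l)) ≡ top m (T.prodOf m (columnForm m) l)
per-matrix {m} l = begin
  per A                                                ≡⟨ perOn-full A ⟩
  perOn (const true) A                                 ≡⟨ top-column (const true) A ⟨
  top m (T.product m (column A))                       ≡⟨ top-cong m (T.product-cong m (column-matrix (List.lookup l))) ⟩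
  top m (T.product m (columnForm m ∘ List.lookup l))   ≡⟨ top-cong m (product-lookup m (columnForm m) l) ⟩
  top m (T.prodOf m (columnForm m) l)                  ∎
  where
  open ≡-Reasoning
  A = matrix (List.lookup l)

generators-square0 : ∀ m → All (T.Square0 m) (generators m)
generators-square0 zero    = []
generators-square0 (suc m) =
  T.trans (suc m) (DL.infinitesimal-* m _ _ _) (T.refl m , T.zeroʳ m _) ∷ DL.square0-dual m (generators-square0 m)

-- Gadgets as elements of the tower.

-- For t ≤ k, the coefficient 2ᵏ t! x₁⋯xₜ of z in the product of the forms of a gadget.
perturbation : ℕ → (k : ℕ) → T.Carrier k
perturbation t k = T._·_ k (weight t k) (T.monomial k t (generators k))

-- At u = 1 all powers of u become 1. The ε-part w stays general so that both signs of z are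
-- covered.
gadget-form : ∀ {t k} → t ≤ k → ∀ w → T.Square0 (suc k) (T.0# k , w) →
  T._≈_ (suc k) (T.prodOf (suc k) (T.form (suc k) (T.1# (suc k)) ((T.0# k , w) ∷ Vec.map (_, T.0# k) (generators k))) (gadget t k))
                (T.1# k , T._*_ k w (perturbation t k))
gadget-form {t} {k} t≤k w sw = begin
  T.prodOf (suc k) (form 1# ((R.0# , w) ∷ Vec.map (_, R.0#) (generators k))) (gadget t k)
    ≈⟨ proj₂ (T.prodOf-gadget (suc k) t≤k) _ (DL.square0-dual k (generators-square0 k)) _ sw 1# ⟩
  1# ^ proj₁ (T.prodOf-gadget (suc k) t≤k) * (1# ^ suc t + (R.0# , w) * (weight t k · monomial t (Vec.map (_, R.0#) (generators k))))
    ≈⟨ *-cong (1^ (proj₁ (T.prodOf-gadget (suc k) t≤k))) (+-cong (1^ (suc t)) (*-congˡ {x = R.0# , w}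
         (trans (×-congʳ (weight t k) (DL.monomial-dual k t (generators k))) (DL.·-dual k (weight t k) _ _)))) ⟩
  1# * (1# + (R.0# , w) * (perturbation t k , weight t k R.· R.0#))
    ≈⟨ trans (*-identityˡ _) (+-congˡ {x = 1#} (DL.infinitesimal-* k w _ _)) ⟩
  1# + (R.0# , w R.* perturbation t k)
    ≈⟨ R.+-identityʳ _ , R.+-identityˡ _ ⟩
  (R.1# , w R.* perturbation t k) ∎
  where
  module R = T k
  open T (suc k)
  open import Relation.Binary.Reasoning.Setoid setoid
  1^ : ∀ n → 1# ^ n ≈ 1#
  1^ zero    = refl
  1^ (suc n) = trans (*-congˡ {x = 1#} (1^ n)) (*-identityˡ 1#)

prodOf-gadget⁺ : ∀ {t k} → t ≤ k →
  T._≈_ (suc k) (T.prodOf (suc k) (columnForm (suc k)) (gadget t k)) (T.1# k , perturbation t k)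
prodOf-gadget⁺ {t} {k} t≤k = T.trans (suc k)
  (gadget-form t≤k (T.1# k) (T.trans (suc k) (DL.infinitesimal-* k _ _ _) (T.refl k , T.zeroʳ k _)))
  (T.refl k , T.*-identityˡ k _)

prodOf-gadget⁻ : ∀ {t k} → t ≤ k →
  T._≈_ (suc k) (T.prodOf (suc k) (columnForm (suc k)) (map flipHead (gadget t k))) (T.1# k , T.-_ k (perturbation t k))
prodOf-gadget⁻ {t} {k} t≤k = T.trans (suc k)
  (T.prodOf-map (suc k) flipped (gadget t k))
  (T.trans (suc k)
    (gadget-form t≤k (T.-_ k (T.1# k)) (T.trans (suc k) (DL.infinitesimal-* k _ _ _) (T.refl k , T.zeroʳ k _)))
    (T.refl k , T.trans k (T.sym k (-‿distribˡ-* _ _)) (T.-‿cong k (T.*-identityˡ k _))))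
  where
  open import Algebra.Properties.Ring (CommutativeRing.ring (Tower k)) using (-‿distribˡ-*; -0#≈0#)
  xs = Vec.map (_, T.0# k) (generators k)
  flipped : ∀ c → T._≈_ (suc k) (columnForm (suc k) (flipHead c))
                    (T.form (suc k) (T.1# (suc k)) ((T.0# k , T.-_ k (T.1# k)) ∷ xs) c)
  -- Negating the first generator produces the constant part -0, which is replaced by 0.
  flipped (ε ∷ c) = T.trans (suc k) (T.form-flip (suc k) _ _ xs (ε ∷ c))
    (T.form-cong (suc k) xs c (T.+-congˡ (suc k) {x = T.1# (suc k)}
      (T.trans (suc k) (DL.∙-dual k ε _ _) (T.trans (suc k) (neg0 ε , T.refl k) (T.sym (suc k) (DL.∙-dual k ε _ _))))))
    where
    neg0 : ∀ ε → T._≈_ k (T._∙_ k ε (T.-_ k (T.0# k))) (T._∙_ k ε (T.0# k))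
    neg0 plus  = -0#≈0#
    neg0 minus = T.-‿cong k -0#≈0#

-- Counting distinct values.

open import Data.Nat using (_^_)

allVecsOf-complete : ∀ {A : Set} {xs : List A} → (∀ a → a ∈ xs) → ∀ {m} (v : Vec A m) → v ∈ allVecsOf xs m
allVecsOf-complete p []      = here ≡.refl
allVecsOf-complete p (a ∷ v) = ∈-concatMap⁺ _ (Any.map (λ { ≡.refl → ∈-map⁺ (_∷ v) (p a) }) (allVecsOf-complete p v))

∈-Ω : ∀ {m n} (A : Mat m n) → A ∈ Ω m n
∈-Ω = allVecsOf-complete (allVecsOf-complete λ { plus → here ≡.refl ; minus → there (here ≡.refl) })

-- Every permanent has a position in the list of distinct values, and equal positions mean equal
-- permanents, so `Fin K` injects into the positions.
distinct-permanents : ∀ {K m n} (f : Fin K → Mat m n) → (∀ {i j} → per (f i) ≡ per (f j) → i ≡ j) → K ≤ r m n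
distinct-permanents {m = m} {n} f inj = injective⇒≤ λ {i} {j} eq →
  inj (≡.trans (lookup-index (mem i)) (≡.trans (≡.cong (List.lookup values) eq) (≡.sym (lookup-index (mem j)))))
  where
  values = deduplicate ℤ._≟_ (map per (Ω m n))
  mem : ∀ i → per (f i) ∈ values
  mem i = ∈-deduplicate⁺ ℤ._≟_ (∈-map⁺ per (∈-Ω (f i)))

-- Digit vectors and mixed radix expansions.

funToFin-cong : ∀ {l Q} {f g : Fin l → Fin Q} → (∀ x → f x ≡ g x) → funToFin f ≡ funToFin g
funToFin-cong {zero}  p = ≡.refl
funToFin-cong {suc l} p = ≡.cong₂ combine (p zero) (funToFin-cong (p ∘ suc))

digits : ∀ Q l → Fin (Q ^ l) → Vec (Fin Q) l
digits Q l i = tabulate (finToFun {Q} {l} i)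

digits-injective : ∀ Q l i j → digits Q l i ≡ digits Q l j → i ≡ j
digits-injective Q l i j eq = begin
  i                            ≡⟨ funToFin-finToFin {l} {Q} i ⟨
  funToFin (finToFun {Q} {l} i) ≡⟨ funToFin-cong pointwise ⟩
  funToFin (finToFun {Q} {l} j) ≡⟨ funToFin-finToFin {l} {Q} j ⟩
  j                            ∎
  where
  open ≡-Reasoning
  pointwise : ∀ x → finToFun {Q} {l} i x ≡ finToFun {Q} {l} j x
  pointwise x = begin
    finToFun {Q} {l} i x     ≡⟨ lookup∘tabulate (finToFun {Q} {l} i) x ⟨
    lookup (digits Q l i) x  ≡⟨ ≡.cong (λ v → lookup v x) eq ⟩
    lookup (digits Q l j) x  ≡⟨ lookup∘tabulate (finToFun {Q} {l} j) x ⟩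
    finToFun {Q} {l} j x     ∎

-- The place values are b 0, b 1, ..., with the most significant digit first.
radix : ∀ {Q l} → (ℕ → ℕ) → Vec (Fin Q) l → ℕ
radix b []       = 0
radix b (y ∷ ys) = toℕ y ℕ.* b 0 ℕ.+ radix (b ∘ suc) ys

-- The lower places together stay below one unit of b 0, so the whole value stays below `toℕ y` + 1
-- ≤ Q such units. This and the bound on the tail are proved by mutual induction.
radix-< : ∀ {Q} l b → (∀ {i} → i < l → Q ℕ.* b (suc i) ≤ b i) → 0 < b l → (ys : Vec (Fin Q) (suc l)) → radix b ys < Q ℕ.* b 0
radix-tail-< : ∀ {Q} l b → (∀ {i} → i < l → Q ℕ.* b (suc i) ≤ b i) → 0 < b l → (ys : Vec (Fin Q) l) → radix (b ∘ suc) ys < b 0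

radix-< {Q} l b dec pos (y ∷ ys) = begin-strict
  toℕ y ℕ.* b 0 ℕ.+ radix (b ∘ suc) ys <⟨ ℕ.+-monoʳ-< (toℕ y ℕ.* b 0) (radix-tail-< l b dec pos ys) ⟩
  toℕ y ℕ.* b 0 ℕ.+ b 0                ≡⟨ ℕ.+-comm (toℕ y ℕ.* b 0) (b 0) ⟩
  suc (toℕ y) ℕ.* b 0                  ≤⟨ ℕ.*-monoˡ-≤ (b 0) (toℕ<n y) ⟩
  Q ℕ.* b 0                            ∎
  where open ℕ.≤-Reasoning

radix-tail-< zero    b dec pos []       = pos
radix-tail-< (suc l) b dec pos ys@(_ ∷ _) = ℕ.<-≤-trans (radix-< l (b ∘ suc) (dec ∘ s≤s) pos ys) (dec (s≤s z≤n))

quotient-unique : ∀ {d} q q′ {s s′} → s < d → s′ < d → q ℕ.* d ℕ.+ s ≡ q′ ℕ.* d ℕ.+ s′ → q ≡ q′ × s ≡ s′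
quotient-unique zero     zero     s<d s′<d eq = ≡.refl , eq
quotient-unique {d} zero     (suc q′) {s} {s′} s<d s′<d eq = contradiction
  (≡.subst (d ≤_) (≡.sym eq) (ℕ.≤-trans (ℕ.m≤m+n d (q′ ℕ.* d)) (ℕ.m≤m+n _ s′))) (ℕ.<⇒≱ s<d)
quotient-unique {d} (suc q)  zero     {s} {s′} s<d s′<d eq = contradiction
  (≡.subst (d ≤_) eq (ℕ.≤-trans (ℕ.m≤m+n d (q ℕ.* d)) (ℕ.m≤m+n _ s))) (ℕ.<⇒≱ s′<d)
quotient-unique {d} (suc q)  (suc q′) {s} {s′} s<d s′<d eq
  with quotient-unique q q′ s<d s′<d (ℕ.+-cancelˡ-≡ d _ _
         (≡.trans (≡.sym (ℕ.+-assoc d (q ℕ.* d) s)) (≡.trans eq (ℕ.+-assoc d (q′ ℕ.* d) s′))))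
... | q≡q′ , s≡s′ = ≡.cong suc q≡q′ , s≡s′

-- Division by b 0 recovers the leading digit as quotient and the value of the lower digits as
-- remainder.
radix-injective : ∀ {Q} l b → (∀ {i} → i < l → Q ℕ.* b (suc i) ≤ b i) → 0 < b l →
                  (ys zs : Vec (Fin Q) (suc l)) → radix b ys ≡ radix b zs → ys ≡ zs
radix-injective l b dec pos (y ∷ ys) (z ∷ zs) eq
  with quotient-unique (toℕ y) (toℕ z) (radix-tail-< l b dec pos ys) (radix-tail-< l b dec pos zs) eq
radix-injective zero    b dec pos (y ∷ []) (z ∷ []) eq | y≡z , _ = ≡.cong (_∷ []) (toℕ-injective y≡z)
radix-injective (suc l) b dec pos (y ∷ ys) (z ∷ zs) eq | y≡z , eq′ =
  ≡.cong₂ _∷_ (toℕ-injective y≡z) (radix-injective l (b ∘ suc) (dec ∘ s≤s) pos ys zs eq′)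

-- Assembling lists of columns from digits.

copies : ∀ {A : Set} → ℕ → List A → List A
copies n l = concat (replicate n l)

-- A digit always takes Y blocks, whatever its value. When all blocks have the same length, the
-- width of the matrix is therefore independent of the digits.
blocks : ∀ {A : Set} {Y l} → (pos neg : ℕ → List A) → Vec (Fin (suc Y)) l → List A
blocks             pos neg []       = []
blocks {Y = Y} pos neg (y ∷ ys) =
  copies (toℕ y) (pos 0) ++ copies (Y ∸ toℕ y) (neg 0) ++ blocks (pos ∘ suc) (neg ∘ suc) ys

length-copies : ∀ {A : Set} n (l : List A) → length (copies n l) ≡ n ℕ.* length l
length-copies zero    l = ≡.refl
length-copies (suc n) l = ≡.trans (length-++ l) (≡.cong (length l ℕ.+_) (length-copies n l))

length-blocks : ∀ {A : Set} {Y l} (pos neg : ℕ → List A) c → (∀ {i} → i < l → length (pos i) ≡ c × length (neg i) ≡ c) →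
                (ys : Vec (Fin (suc Y)) l) → length (blocks pos neg ys) ≡ l ℕ.* (Y ℕ.* c)
length-blocks pos neg c p [] = ≡.refl
length-blocks {Y = Y} {suc l} pos neg c p (y ∷ ys) = begin
  length (copies (toℕ y) (pos 0) ++ copies (Y ∸ toℕ y) (neg 0) ++ rest)
    ≡⟨ ≡.trans (length-++ (copies (toℕ y) (pos 0))) (≡.cong (length (copies (toℕ y) (pos 0)) ℕ.+_) (length-++ (copies (Y ∸ toℕ y) (neg 0)))) ⟩
  length (copies (toℕ y) (pos 0)) ℕ.+ (length (copies (Y ∸ toℕ y) (neg 0)) ℕ.+ length rest)
    ≡⟨ ≡.cong₂ ℕ._+_ (≡.trans (length-copies (toℕ y) (pos 0)) (≡.cong (toℕ y ℕ.*_) (proj₁ (p (s≤s z≤n)))))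
        (≡.cong₂ ℕ._+_ (≡.trans (length-copies (Y ∸ toℕ y) (neg 0)) (≡.cong ((Y ∸ toℕ y) ℕ.*_) (proj₂ (p (s≤s z≤n)))))
           (length-blocks (pos ∘ suc) (neg ∘ suc) c (p ∘ s≤s) ys)) ⟩
  toℕ y ℕ.* c ℕ.+ ((Y ∸ toℕ y) ℕ.* c ℕ.+ l ℕ.* (Y ℕ.* c))
    ≡⟨ regroup (toℕ y) (Y ∸ toℕ y) c _ ⟩
  (toℕ y ℕ.+ (Y ∸ toℕ y)) ℕ.* c ℕ.+ l ℕ.* (Y ℕ.* c)
    ≡⟨ ≡.cong (λ z → z ℕ.* c ℕ.+ l ℕ.* (Y ℕ.* c)) (ℕ.m+[n∸m]≡n (ℕ.≤-pred (toℕ<n y))) ⟩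
  suc l ℕ.* (Y ℕ.* c) ∎
  where
  open ≡-Reasoning
  rest = blocks (pos ∘ suc) (neg ∘ suc) ys
  regroup : ∀ a b c d → a ℕ.* c ℕ.+ (b ℕ.* c ℕ.+ d) ≡ (a ℕ.+ b) ℕ.* c ℕ.+ d
  regroup = ℕ-Solver.solve-∀

length-double : ∀ {A B : Set} (f g : A → B) l {n} → length l ≡ n → length (map f l ++ map g l) ≡ 2 ℕ.* n
length-double f g l p = ≡.trans (length-++ (map f l))
  (≡.cong₂ ℕ._+_ (≡.trans (length-map f l) p) (≡.trans (length-map g l) (≡.trans p (≡.sym (ℕ.+-identityʳ _)))))

length-gadget : ∀ {t k} → t ≤ k → length (gadget t k) ≡ 2 ^ k
length-gadget {zero}  {zero}  z≤n       = ≡.refl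
length-gadget {zero}  {suc k} z≤n       = length-double _ _ (gadget 0 k) (length-gadget {0} {k} z≤n)
length-gadget {suc t} {suc k} (s≤s t≤k) = length-double _ _ (gadget t k) (length-gadget t≤k)

-- Products of blocks with constant part 1.

module Unipotent (R : CommutativeRing 0ℓ 0ℓ) where
  open CommutativeRing R hiding (zero)
  open Columns R using (_·_)
  open DualLemmas R using (unipotent-*)
  private
    module D = CommutativeRing (Dual R)
  open Columns (Dual R) using (prodOf; prodOf-++)

  total : ∀ {Y l} → (ℕ → Carrier) → Vec (Fin (suc Y)) l → Carrier
  total             B []       = 0#
  total {Y} B (y ∷ ys) = toℕ y · B 0 + ((Y ∸ toℕ y) · (- B 0) + total (B ∘ suc) ys)

  module _ {A : Set} (f : A → D.Carrier) where
    prodOf-copies : ∀ n {l β} → prodOf f l D.≈ (1# , β) → prodOf f (copies n l) D.≈ (1# , n · β)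
    prodOf-copies zero    p = D.refl
    prodOf-copies (suc n) {l} p = D.trans (prodOf-++ f l _)
      (D.trans (D.*-cong p (prodOf-copies n p)) (unipotent-* _ _))

    prodOf-blocks : ∀ {Y l} (pos neg : ℕ → List A) B →
      (∀ {i} → i < l → prodOf f (pos i) D.≈ (1# , B i) × prodOf f (neg i) D.≈ (1# , - B i)) →
      (ys : Vec (Fin (suc Y)) l) → prodOf f (blocks pos neg ys) D.≈ (1# , total B ys)
    prodOf-blocks pos neg B p [] = D.refl
    prodOf-blocks {Y} pos neg B p (y ∷ ys) = D.trans (prodOf-++ f (copies (toℕ y) (pos 0)) _) (D.trans
      (D.*-cong (prodOf-copies (toℕ y) (proj₁ (p (s≤s z≤n)))) (D.trans (prodOf-++ f (copies (Y ∸ toℕ y) (neg 0)) _) (D.trans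
        (D.*-cong (prodOf-copies (Y ∸ toℕ y) (proj₂ (p (s≤s z≤n)))) (prodOf-blocks (pos ∘ suc) (neg ∘ suc) (B ∘ suc) (p ∘ s≤s) ys))
        (unipotent-* _ _))))
      (unipotent-* _ _))

module U (m : ℕ) = Unipotent (Tower m)

-- Top coefficients of the blocks.

top-· : ∀ m n x → top m (T._·_ m n x) ≡ + n ℤ.* top m x
top-· m zero    x = ≡.trans (top-0 m) (≡.sym (ℤ.*-zeroˡ (top m x)))
top-· m (suc n) x = ≡.trans (top-+ m x _) (≡.trans (≡.cong (ℤ._+_ (top m x)) (top-· m n x)) (≡.sym (ℤ.suc-* (+ n) (top m x))))

-- y b - (Y - y) b = 2 y b - Y b, and the terms Y b make up c.
top-total : ∀ m p {Y l} B b → (∀ {i} → i < l → top m (T._*_ m (B i) p) ≡ + b i) →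
  ∃ λ c → (ys : Vec (Fin (suc Y)) l) → top m (T._*_ m (U.total m B ys) p) ℤ.+ c ≡ + (2 ℕ.* radix b ys)
top-total m p {l = zero} B b h = + 0 , λ { [] → ≡.trans (ℤ.+-identityʳ _) (≡.trans (top-cong m (T.zeroˡ m p)) (top-0 m)) }
top-total m p {Y} {suc l} B b h = + Y ℤ.* + b 0 ℤ.+ c , λ { (y ∷ ys) → begin
    top m (T._*_ m (U.total m B (y ∷ ys)) p) ℤ.+ (+ Y ℤ.* + b 0 ℤ.+ c)
      ≡⟨ ≡.cong (ℤ._+ (+ Y ℤ.* + b 0 ℤ.+ c)) (expand (toℕ y) (Y ∸ toℕ y) (U.total m (B ∘ suc) ys)) ⟩
    (+ toℕ y ℤ.* + b 0 ℤ.+ (+ (Y ∸ toℕ y) ℤ.* (ℤ.- + b 0) ℤ.+ rest ys)) ℤ.+ (+ Y ℤ.* + b 0 ℤ.+ c)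
      -- Writing Y as y + (Y - y) makes the negative contributions cancel against the added constant
      -- and doubles the positive ones.
      ≡⟨ ≡.cong (λ z → (+ toℕ y ℤ.* + b 0 ℤ.+ (+ (Y ∸ toℕ y) ℤ.* (ℤ.- + b 0) ℤ.+ rest ys)) ℤ.+ (+ z ℤ.* + b 0 ℤ.+ c))
           (ℕ.m+[n∸m]≡n (ℕ.≤-pred (toℕ<n y))) ⟨
    (+ toℕ y ℤ.* + b 0 ℤ.+ (+ (Y ∸ toℕ y) ℤ.* (ℤ.- + b 0) ℤ.+ rest ys)) ℤ.+ ((+ toℕ y ℤ.+ + (Y ∸ toℕ y)) ℤ.* + b 0 ℤ.+ c)
      ≡⟨ regroup (+ toℕ y) (+ (Y ∸ toℕ y)) (+ b 0) (rest ys) c ⟩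
    + 2 ℤ.* (+ toℕ y ℤ.* + b 0) ℤ.+ (rest ys ℤ.+ c)
      ≡⟨ ≡.cong₂ ℤ._+_ (≡.trans (≡.cong (+ 2 ℤ.*_) (≡.sym (ℤ.pos-* (toℕ y) (b 0)))) (≡.sym (ℤ.pos-* 2 (toℕ y ℕ.* b 0)))) (proj₂ ih ys) ⟩
    + (2 ℕ.* (toℕ y ℕ.* b 0) ℕ.+ 2 ℕ.* radix (b ∘ suc) ys)
      ≡⟨ ≡.cong +_ (ℕ.*-distribˡ-+ 2 (toℕ y ℕ.* b 0) _) ⟨
    + (2 ℕ.* radix b (y ∷ ys)) ∎ }
  where
  open ≡-Reasoning
  ih = top-total m p {Y} {l} (B ∘ suc) (b ∘ suc) (h ∘ s≤s)
  c = proj₁ ih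
  rest : Vec (Fin (suc Y)) l → ℤ
  rest ys = top m (T._*_ m (U.total m (B ∘ suc) ys) p)
  h0 : top m (T._*_ m (B 0) p) ≡ + b 0
  h0 = h (s≤s z≤n)
  h0′ : top m (T._*_ m (T.-_ m (B 0)) p) ≡ ℤ.- + b 0
  h0′ = ≡.trans (top-cong m (T.sym m (-‿distribˡ-* (B 0) p))) (≡.trans (top-neg m _) (≡.cong ℤ.-_ h0))
    where open import Algebra.Properties.Ring (CommutativeRing.ring (Tower m)) using (-‿distribˡ-*)
  multiple : ∀ n x {z} → top m (T._*_ m x p) ≡ z → top m (T._*_ m (T._·_ m n x) p) ≡ + n ℤ.* z
  multiple n x q = ≡.trans (top-cong m (T.×-assoc-* m n x p)) (≡.trans (top-· m n _) (≡.cong (+ n ℤ.*_) q))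
  expand : ∀ i j x → top m (T._*_ m (T._+_ m (T._·_ m i (B 0)) (T._+_ m (T._·_ m j (T.-_ m (B 0))) x)) p) ≡
           + i ℤ.* + b 0 ℤ.+ (+ j ℤ.* (ℤ.- + b 0) ℤ.+ top m (T._*_ m x p))
  expand i j x = ≡.trans (top-cong m (T.trans m (T.distribʳ m p _ _) (T.+-congˡ m (T.distribʳ m p _ _))))
    (≡.trans (top-+ m _ _) (≡.cong₂ ℤ._+_ (multiple i (B 0) h0)
      (≡.trans (top-+ m _ _) (≡.cong (ℤ._+ top m (T._*_ m x p)) (multiple j _ h0′)))))
  regroup : ∀ a d b r c → (a ℤ.* b ℤ.+ (d ℤ.* (ℤ.- b) ℤ.+ r)) ℤ.+ ((a ℤ.+ d) ℤ.* b ℤ.+ c) ≡ + 2 ℤ.* (a ℤ.* b) ℤ.+ (r ℤ.+ c)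
  regroup = ℤ-Solver.solve-∀

-- Columns of ones and falling factorials.

-- `_P′_` unfolds at its smallest factor, whereas the power rule in `top-allOnes` splits off the
-- largest.
P′-suc : ∀ n j → suc n P′ suc j ≡ suc n ℕ.* (n P′ j)
P′-suc n zero    = ≡.refl
P′-suc n (suc j) = ≡.trans (≡.cong ((n ∸ j) ℕ.*_) (P′-suc n j)) (swap (n ∸ j) (suc n) (n P′ j))
  where
  swap : ∀ a b c → a ℕ.* (b ℕ.* c) ≡ b ℕ.* (a ℕ.* c)
  swap = ℕ-Solver.solve-∀

allOnes : ∀ k → T.Carrier k
allOnes k = columnForm k (Vec.replicate k plus)

-- Multiplication by x₁⋯xₜ leaves the coefficient of the remaining k - t variables in the N-th power
-- of their sum plus 1. It counts the injections of k - t rows into N columns.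
top-allOnes : ∀ {t k} → t ≤ k → ∀ N → top k (T._*_ k (T._^_ k (allOnes k) N) (T.monomial k t (generators k))) ≡ + (N P′ (k ∸ t))
top-allOnes {zero} {zero} z≤n N = ≡.trans (ℤ.*-identityʳ _) (1^ N)
  where
  1^ : ∀ N → T._^_ 0 (+ 1) N ≡ + 1
  1^ zero    = ≡.refl
  1^ (suc N) = ≡.trans (ℤ.*-identityˡ _) (1^ N)
-- Without columns the power is 1, whose top coefficient is 0 as there is at least one variable. On
-- the right the truncated factor 0 ∸ k is 0.
top-allOnes {zero} {suc k} z≤n zero = ≡.trans (top-cong (suc k) (T.*-identityʳ (suc k) (T.1# (suc k))))
  (≡.trans (top-0 k) (≡.cong (λ z → + (z ℕ.* (0 P′ k))) (≡.sym (ℕ.0∸n≡0 k))))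
top-allOnes {zero} {suc k} z≤n (suc N) = begin
  top (suc k) (T._*_ (suc k) (T._^_ (suc k) (allOnes (suc k)) (suc N)) (T.1# (suc k)))
    ≡⟨ top-cong (suc k) (T.trans (suc k) (T.*-identityʳ (suc k) _)
         (T.^-congˡ (suc k) (suc N) (columnForm-∷ k plus (Vec.replicate k plus)))) ⟩
  top (suc k) (T._^_ (suc k) (allOnes k , T.1# k) (suc N))
    ≡⟨ top-cong k (DL.proj₂-^ k (allOnes k) N) ⟩
  top k (T._·_ k (suc N) (T._^_ k (allOnes k) N))
    ≡⟨ top-· k (suc N) _ ⟩
  + suc N ℤ.* top k (T._^_ k (allOnes k) N)
    ≡⟨ ≡.cong (+ suc N ℤ.*_) (≡.trans (top-cong k (T.sym k (T.*-identityʳ k _))) (top-allOnes {zero} {k} z≤n N)) ⟩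
  + suc N ℤ.* + (N P′ k)
    ≡⟨ ≡.trans (≡.sym (ℤ.pos-* (suc N) (N P′ k))) (≡.cong +_ (≡.sym (P′-suc N k))) ⟩
  + (suc N P′ suc k) ∎
  where open ≡-Reasoning
top-allOnes {suc t} {suc k} (s≤s t≤k) N = begin
  top (suc k) (σ^N * ((T.0# k , T.1# k) * T.monomial (suc k) t (Vec.map (_, T.0# k) (generators k))))
    ≡⟨ top-cong (suc k) (*-congˡ {x = σ^N} (trans (*-congˡ {x = T.0# k , T.1# k} (DL.monomial-dual k t (generators k)))
         (trans (DL.infinitesimal-* k _ _ _) (T.refl k , T.*-identityˡ k _)))) ⟩
  top k (T._+_ k (T._*_ k (proj₁ σ^N) mono) (T._*_ k (proj₂ σ^N) (T.0# k)))
    ≡⟨ top-cong k (T.trans k (T.+-congˡ k (T.zeroʳ k _)) (T.+-identityʳ k _)) ⟩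
  top k (T._*_ k (proj₁ σ^N) mono)
    ≡⟨ top-cong k (T.*-congʳ k (T.trans k (DL.proj₁-^ k (allOnes (suc k)) N)
         (T.^-congˡ k N (proj₁ (columnForm-∷ k plus (Vec.replicate k plus)))))) ⟩
  top k (T._*_ k (T._^_ k (allOnes k) N) mono)
    ≡⟨ top-allOnes t≤k N ⟩
  + (N P′ (k ∸ t)) ∎
  where
  open ≡-Reasoning
  open T (suc k) using (_*_; *-congˡ; trans)
  σ^N = T._^_ (suc k) (allOnes (suc k)) N
  mono = T.monomial k t (generators k)

-- The place values and their decrease.

weight-suc : ∀ {t k} → t < k → weight (suc t) k ≡ suc t ℕ.* weight t k
weight-suc {zero}  {suc k} (s≤s z≤n) = ≡.sym (ℕ.*-identityˡ _)
weight-suc {suc t} {suc k} (s≤s t<k) = ≡.trans (≡.cong ((2 ℕ.* suc (suc t)) ℕ.*_) (weight-suc t<k)) (regroup (suc (suc t)) (suc t) (weight t k))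
  where
  regroup : ∀ a b c → (2 ℕ.* a) ℕ.* (b ℕ.* c) ≡ a ℕ.* ((2 ℕ.* b) ℕ.* c)
  regroup = ℕ-Solver.solve-∀

weight-pos : ∀ {t k} → t ≤ k → 0 < weight t k
weight-pos {zero}  {zero}  z≤n       = s≤s z≤n
weight-pos {zero}  {suc k} z≤n       = ℕ.*-mono-< {0} {2} (s≤s z≤n) (weight-pos {zero} {k} z≤n)
weight-pos {suc t} {suc k} (s≤s t≤k) = ℕ.*-mono-< {0} {2 ℕ.* suc t} (s≤s z≤n) (weight-pos t≤k)

-- The place value of the digit yₜ: what a single gadget of kind t contributes next to N columns of
-- ones.
scale : (k N t : ℕ) → ℕ
scale k N t = weight t k ℕ.* (N P′ (k ∸ t))

scale-pos : ∀ k N → 0 < scale k N k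
scale-pos k N rewrite ℕ.n∸n≡0 k | ℕ.*-identityʳ (weight k k) = weight-pos {k} ℕ.≤-refl

-- Consecutive place values have the quotient (N - j) / (t + 1) with j = k - t - 1, and (Y + 1)(t +
-- 1) + j ≤ (Y + 1)k ≤ N.
scale-dec : ∀ {k N Y t} → suc Y ℕ.* k ≤ N → t < k → suc Y ℕ.* scale k N (suc t) ≤ scale k N t
scale-dec {k} {N} {Y} {t} big t<k = begin
  suc Y ℕ.* (weight (suc t) k ℕ.* (N P′ j))            ≡⟨ ≡.cong (λ w → suc Y ℕ.* (w ℕ.* (N P′ j))) (weight-suc t<k) ⟩
  suc Y ℕ.* ((suc t ℕ.* weight t k) ℕ.* (N P′ j))      ≡⟨ regroup (suc Y) (suc t) (weight t k) (N P′ j) ⟩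
  weight t k ℕ.* ((suc Y ℕ.* suc t) ℕ.* (N P′ j))      ≤⟨ ℕ.*-monoʳ-≤ (weight t k) (ℕ.*-monoˡ-≤ (N P′ j) room) ⟩
  weight t k ℕ.* (N P′ suc j)                          ≡⟨ ≡.cong (λ i → weight t k ℕ.* (N P′ i)) (ℕ.+-∸-assoc 1 t<k) ⟨
  weight t k ℕ.* (N P′ (k ∸ t))                        ∎
  where
  open ℕ.≤-Reasoning
  j = k ∸ suc t
  regroup : ∀ a b c d → a ℕ.* ((b ℕ.* c) ℕ.* d) ≡ c ℕ.* ((a ℕ.* b) ℕ.* d)
  regroup = ℕ-Solver.solve-∀
  room : suc Y ℕ.* suc t ≤ N ∸ j
  room = ℕ.m+n≤o⇒m≤o∸n _ (begin
    suc Y ℕ.* suc t ℕ.+ j             ≤⟨ ℕ.+-monoʳ-≤ (suc Y ℕ.* suc t) (ℕ.m≤m+n j (Y ℕ.* j)) ⟩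
    suc Y ℕ.* suc t ℕ.+ suc Y ℕ.* j   ≡⟨ ℕ.*-distribˡ-+ (suc Y) (suc t) j ⟨
    suc Y ℕ.* (suc t ℕ.+ j)           ≡⟨ ≡.cong (suc Y ℕ.*_) (ℕ.m+[n∸m]≡n t<k) ⟩
    suc Y ℕ.* k                       ≤⟨ big ⟩
    N                                 ∎)

-- The family of matrices and its permanents.

columnsOf : ∀ k {Y} N → Vec (Fin (suc Y)) (suc k) → List (Vec PM (suc k))
columnsOf k N ys =
  blocks (λ t → gadget t k) (λ t → map flipHead (gadget t k)) ys ++ replicate N (Vec.replicate (suc k) plus)

length-columnsOf : ∀ k {Y} N ys → length (columnsOf k {Y} N ys) ≡ suc k ℕ.* (Y ℕ.* 2 ^ k) ℕ.+ N
length-columnsOf k N ys = ≡.trans (length-++ (blocks (λ t → gadget t k) _ ys)) (≡.cong₂ ℕ._+_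
  (length-blocks _ _ (2 ^ k) (λ { {t} (s≤s t≤k) → length-gadget t≤k , ≡.trans (length-map flipHead (gadget t k)) (length-gadget t≤k) }) ys)
  (length-replicate N))

permanent : ∀ k {Y} → Vec (Fin (suc Y)) (suc k) → ℕ → ℤ
permanent k ys N = top (suc k) (T.prodOf (suc k) (columnForm (suc k)) (columnsOf k N ys))

-- As z² = 0, z comes either from a column of ones, which gives C, or from a gadget, which gives the
-- digit sum. The constant c is chosen before `ys`, so equal permanents force equal radix values.
permanent-formula : ∀ k {Y} N → ∃ λ c → (ys : Vec (Fin (suc Y)) (suc k)) →
                    permanent k ys N ℤ.+ c ≡ + (2 ℕ.* radix (scale k N) ys)
permanent-formula k {Y} N = ℤ.- C ℤ.+ proj₁ totals , λ ys → begin
  permanent k ys N ℤ.+ (ℤ.- C ℤ.+ c)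
    ≡⟨ ≡.cong (ℤ._+ (ℤ.- C ℤ.+ c)) (top-cong (suc k) (T.trans (suc k) (T.prodOf-++ (suc k) f (blocks _ _ ys) _)
         (T.*-congʳ (suc k) {x = ones} (U.prodOf-blocks k f _ _ B (λ { (s≤s t≤k) → prodOf-gadget⁺ t≤k , prodOf-gadget⁻ t≤k }) ys)))) ⟩
  top k (T._+_ k (T._*_ k (T.1# k) (proj₂ ones)) (T._*_ k (U.total k B ys) (proj₁ ones))) ℤ.+ (ℤ.- C ℤ.+ c)
    ≡⟨ ≡.cong (ℤ._+ (ℤ.- C ℤ.+ c)) (≡.trans (top-+ k _ _) (≡.cong₂ ℤ._+_ (top-cong k (T.*-identityˡ k _)) (top-cong k (T.*-congˡ k ones₁)))) ⟩
  C ℤ.+ V ys ℤ.+ (ℤ.- C ℤ.+ c)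
    ≡⟨ cancel C (V ys) c ⟩
  V ys ℤ.+ c
    ≡⟨ proj₂ totals ys ⟩
  + (2 ℕ.* radix (scale k N) ys) ∎
  where
  open ≡-Reasoning
  f = columnForm (suc k)
  B : ℕ → T.Carrier k
  B t = perturbation t k
  ones = T.prodOf (suc k) f (replicate N (Vec.replicate (suc k) plus))
  C = top k (proj₂ ones)
  σ^N = T._^_ k (allOnes k) N
  ones₁ : T._≈_ k (proj₁ ones) σ^N
  ones₁ = go N
    where
    go : ∀ N → T._≈_ k (proj₁ (T.prodOf (suc k) f (replicate N (Vec.replicate (suc k) plus)))) (T._^_ k (allOnes k) N)
    go zero    = T.refl k
    go (suc N) = T.*-cong k (proj₁ (columnForm-∷ k plus (Vec.replicate k plus))) (go N)
  top-B : ∀ {t} → t < suc k → top k (T._*_ k (B t) σ^N) ≡ + scale k N t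
  top-B {t} (s≤s t≤k) = ≡.trans (top-cong k (T.trans k (T.×-assoc-* k (weight t k) _ _) (T.×-congʳ k (weight t k) (T.*-comm k _ _))))
    (≡.trans (top-· k (weight t k) _) (≡.trans (≡.cong (+ weight t k ℤ.*_) (top-allOnes t≤k N)) (≡.sym (ℤ.pos-* (weight t k) _))))
  totals = top-total k σ^N {Y} {suc k} B (scale k N) top-B
  c = proj₁ totals
  V : Vec (Fin (suc Y)) (suc k) → ℤ
  V ys = top k (T._*_ k (U.total k B ys) σ^N)
  cancel : ∀ a b c → a ℤ.+ b ℤ.+ (ℤ.- a ℤ.+ c) ≡ b ℤ.+ c
  cancel = ℤ-Solver.solve-∀

permanent-injective : ∀ k {Y N} → suc Y ℕ.* k ≤ N → (ys zs : Vec (Fin (suc Y)) (suc k)) →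
                      permanent k ys N ≡ permanent k zs N → ys ≡ zs
permanent-injective k {Y} {N} big ys zs eq = radix-injective k (scale k N) (scale-dec {k} {N} {Y} big) (scale-pos k N) ys zs
  (ℕ.*-cancelˡ-≡ _ _ 2 (ℤ.+-injective (≡.trans (≡.sym (proj₂ (permanent-formula k N) ys))
    (≡.trans (≡.cong (ℤ._+ proj₁ (permanent-formula k {Y} N)) eq) (proj₂ (permanent-formula k N) zs)))))

realise : ∀ {m n} (l : List (Vec PM m)) → length l ≡ n → ∃ λ (A : Mat m n) → per A ≡ top m (T.prodOf m (columnForm m) l)
realise l ≡.refl = matrix (List.lookup l) , per-matrix l

-- The gadgets occupy `M` columns. The hypothesis leaves at least (Y + 1)k columns of ones, as the
-- decrease of the place values requires.
r-lower : ∀ k Y n → suc k ℕ.* (Y ℕ.* 2 ^ k) ℕ.+ suc Y ℕ.* k ≤ n → suc Y ^ suc k ≤ r (suc k) n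
r-lower k Y n h = distinct-permanents (proj₁ ∘ A) λ {i} {j} eq → digits-injective (suc Y) (suc k) i j
  (permanent-injective k (ℕ.m+n≤o⇒m≤o∸n _ (≡.subst (_≤ n) (ℕ.+-comm M _) h)) (digits (suc Y) (suc k) i) (digits (suc Y) (suc k) j)
    (≡.trans (≡.sym (proj₂ (A i))) (≡.trans eq (proj₂ (A j)))))
  where
  M = suc k ℕ.* (Y ℕ.* 2 ^ k)
  A : (i : Fin (suc Y ^ suc k)) → ∃ λ (A : Mat (suc k) n) → per A ≡ permanent k (digits (suc Y) (suc k) i) (n ∸ M)
  A i = realise (columnsOf k (n ∸ M) (digits (suc Y) (suc k) i)) (≡.trans (length-columnsOf k (n ∸ M) (digits (suc Y) (suc k) i)) (ℕ.m+[n∸m]≡n (ℕ.≤-trans (ℕ.m≤m+n M _) h)))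

-- The final estimate.

^-distribʳ-* : ∀ l a b → (a ℕ.* b) ^ l ≡ a ^ l ℕ.* b ^ l
^-distribʳ-* zero    a b = ≡.refl
^-distribʳ-* (suc l) a b = ≡.trans (≡.cong ((a ℕ.* b) ℕ.*_) (^-distribʳ-* l a b)) (regroup a b (a ^ l) (b ^ l))
  where
  regroup : ∀ a b c d → (a ℕ.* b) ℕ.* (c ℕ.* d) ≡ (a ℕ.* c) ℕ.* (b ℕ.* d)
  regroup = ℕ-Solver.solve-∀

open import Data.Nat using (_+_; _*_)

-- The constant is the rational p / q, and the inequality is multiplied by q n², which also makes
-- sense of the negative exponent k - 2 for k = 1.
theorem1 : (k : ℕ) → 1 ≤ k →
    Σ ℕ (λ p → Σ ℕ (λ q → 0 < p × 0 < q ×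
    ((n : ℕ) → k + 1 ≤ n → p * n ^ k ≤ q * r (k + 1) n * n ^ 2)))
theorem1 k 1≤k = 1 , (D + k) ^ k , s≤s z≤n , ℕ.m^n>0 (D + k) k , bound
  where
  -- Raising Y by one costs `D` columns: 2ᵏ for each of the k + 1 kinds of gadget, and k more
  -- columns of ones.
  D = suc k * 2 ^ k + k
  instance
    D≢0 : ℕ.NonZero D
    D≢0 = ℕ.>-nonZero (ℕ.≤-trans 1≤k (ℕ.m≤n+m k _))
    D+k≢0 : ℕ.NonZero (D + k)
    D+k≢0 = ℕ.>-nonZero (ℕ.≤-trans 1≤k (ℕ.m≤n+m k D))
  bound : ∀ n → k + 1 ≤ n → 1 * n ^ k ≤ (D + k) ^ k * r (k + 1) n * n ^ 2
  bound n k+1≤n rewrite ℕ.+-comm k 1 = begin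
    1 * n ^ k                           ≡⟨ ℕ.*-identityˡ _ ⟩
    n ^ k                                 ≤⟨ ℕ.^-monoˡ-≤ k n≤ ⟩
    ((D + k) * suc Y) ^ k             ≡⟨ ^-distribʳ-* k (D + k) (suc Y) ⟩
    -- One factor Y + 1 of the count is given up here; the next step uses n² ≥ 1.
    (D + k) ^ k * suc Y ^ k           ≤⟨ ℕ.*-monoʳ-≤ ((D + k) ^ k) (ℕ.≤-trans (ℕ.^-monoʳ-≤ (suc Y) (ℕ.n≤1+n k)) (r-lower k Y n fits)) ⟩
    (D + k) ^ k * r (suc k) n         ≤⟨ ℕ.m≤m*n _ (n ^ 2) ⟩
    (D + k) ^ k * r (suc k) n * n ^ 2 ∎
    where
    open ℕ.≤-Reasoning
    -- The largest Y for which the Y D + k columns fit into n.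
    Y = (n ∸ k) / D
    k≤n : k ≤ n
    k≤n = ℕ.≤-trans (ℕ.n≤1+n k) k+1≤n
    instance
      n≢0 : ℕ.NonZero n
      n≢0 = ℕ.>-nonZero (ℕ.≤-trans (s≤s z≤n) k+1≤n)
      n²≢0 : ℕ.NonZero (n ^ 2)
      n²≢0 = ℕ.m^n≢0 n 2
    n≤ : n ≤ (D + k) * suc Y
    n≤ = begin
      n                               ≡⟨ ℕ.m∸n+n≡m k≤n ⟨
      (n ∸ k) + k                   ≡⟨ ≡.cong (_+ k) (m≡m%n+[m/n]*n (n ∸ k) D) ⟩
      ((n ∸ k) % D + Y * D) + k ≤⟨ ℕ.+-mono-≤ (ℕ.+-monoˡ-≤ (Y * D) (ℕ.<⇒≤ (m%n<n (n ∸ k) D))) (ℕ.m≤m+n k (Y * k)) ⟩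
      suc Y * D + suc Y * k     ≡⟨ regroup (suc Y) D k ⟩
      (D + k) * suc Y             ∎
      where
      regroup : ∀ a b c → a * b + a * c ≡ (b + c) * a
      regroup = ℕ-Solver.solve-∀
    fits : suc k * (Y * 2 ^ k) + suc Y * k ≤ n
    fits = begin
      suc k * (Y * 2 ^ k) + suc Y * k ≡⟨ regroup k Y (2 ^ k) ⟩
      Y * D + k                           ≤⟨ ℕ.+-monoˡ-≤ k (m/n*n≤m (n ∸ k) D) ⟩
      (n ∸ k) + k                           ≡⟨ ℕ.m∸n+n≡m k≤n ⟩
      n                                       ∎
      where
      regroup : ∀ k Y E → suc k * (Y * E) + suc Y * k ≡ Y * (suc k * E + k) + k
      regroup = ℕ-Solver.solve-∀
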